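{- For every function $f:\{0,1\}^n\to\{0,1\}$ computable by a width-3 read-once branching program of length $n$, there is an integer $0\le k\le n$ and a $\mathsf{CNF}^\oplus$ formula $g:\{0,1\}^{n-k}\to\{0,1\}$ such that $\{0^k\circ y: g(y)=1\}\subseteq f^{ -1}(1)$ and $\mathbb{E}[g]\ge(\mathbb{E}[f]/n)^{O(1)}$.
   Context: A read-once branching program (ROBP) of width $d$ and length $n$ has vertex set partitioned into layers $V_0\cup\cdots\cup V_n$ with $V_0=\{(0,0)\}$ (start state), $V_t=\{(t,i)\}_{i\in[d]}$ for $1\le t\le n-1$, $V_n=\{(n,1),(n,d)\}$ ($(n,1)$ accepts, $(n,d)$ rejects). Each vertex of $V_t$ ($t<n$) has two out-edges labeled $0$ and $1$ into $V_{t+1}$. On input $x\in\{0,1\}^n$, start at $(0,0)$ and from layer $t$ follow the edge labeled $x_{t+1}$; $x$ is accepted iff the path ends at $(n,1)$. A $\mathsf{CNF}^\oplus$ formula is a conjunction $\bigwedge_i T_i$ where each $T_i$ is a disjunction of literals or a parity of literals, the $T_i$ on pairwise disjoint variables. $0^k\circ y$ denotes concatenation; $\mathbb{E}$ is under the uniform distribution. -}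

module Defs where

open import Data.Nat using (ℕ; zero; suc; _+_; _^_; NonZero)
open import Data.Nat.Properties using (m^n≢0)
open import Data.Bool using (Bool; true; false; not; _∧_; _∨_; _xor_)
open import Data.Unit using (⊤; tt)
open import Data.Fin using (Fin)
open import Data.Vec using (Vec; []; _∷_; lookup)
open import Data.List using (List; []; _∷_; map; _++_; foldr; length; concatMap)
open import Data.List.Membership.Propositional using (_∈_)
open import Data.List.Relation.Unary.AllPairs using (AllPairs)
open import Data.Empty using (⊥)
open import Data.Integer using (+_)
open import Data.Rational using (ℚ; _/_; _*_; 1ℚ)

-- Read-once branching programs.
-- `Prog d S m` : the remaining part of a ROBP of width d whose current
-- layer has vertex set S and which still reads m input bits.
-- Intermediate layers V_1 … V_{n-1} have vertex set Fin d; the final layer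
-- V_n has two vertices, encoded as Bool (true = (n,1) accept,
-- false = (n,d) reject).  Each vertex has two out-edges, labelled by the
-- read bit (Bool; false = 0, true = 1).
data Prog (d : ℕ) (S : Set) : ℕ → Set where
  last : (S → Bool → Bool) → Prog d S 1
  step : ∀ {m} → (S → Bool → Fin d) → Prog d (Fin d) (suc m) → Prog d S (suc (suc m))

-- A ROBP of width d and length n: layer V_0 is the single start vertex (⊤).
ROBP : ℕ → ℕ → Set
ROBP d n = Prog d ⊤ n

run : ∀ {d S m} → Prog d S m → S → Vec Bool m → Bool
run (last e)   s (b ∷ [])     = e s b
run (step e P) s (b ∷ x)      = run P (e s b) x

evalROBP : ∀ {d n} → ROBP d n → Vec Bool n → Bool
evalROBP P x = run P tt x

record Literal (m : ℕ) : Set where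
  constructor lit
  field
    var      : Fin m
    positive : Bool

data Kind : Set where
  disj parity : Kind

record Term (m : ℕ) : Set where
  constructor term
  field
    kind : Kind
    lits : List (Literal m)

termVars : ∀ {m} → Term m → List (Fin m)
termVars t = map Literal.var (Term.lits t)

record CNF⊕ (m : ℕ) : Set where
  constructor cnf⊕
  field
    terms    : List (Term m)
    disjoint : AllPairs (λ T T′ → ∀ v → v ∈ termVars T → v ∈ termVars T′ → ⊥) terms

evalLit : ∀ {m} → Literal m → Vec Bool m → Bool
evalLit (lit i true)  y = lookup y i
evalLit (lit i false) y = not (lookup y i)

evalTerm : ∀ {m} → Term m → Vec Bool m → Bool
evalTerm (term disj   ls) y = foldr (λ l b → evalLit l y ∨ b) false ls
evalTerm (term parity ls) y = foldr (λ l b → evalLit l y xor b) false ls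

evalCNF⊕ : ∀ {m} → CNF⊕ m → Vec Bool m → Bool
evalCNF⊕ φ y = foldr (λ T b → evalTerm T y ∧ b) true (CNF⊕.terms φ)

allVecs : (n : ℕ) → List (Vec Bool n)
allVecs zero    = [] ∷ []
allVecs (suc n) = map (false ∷_) (allVecs n) ++ map (true ∷_) (allVecs n)

count : ∀ {n} → (Vec Bool n → Bool) → ℕ
count {n} f = foldr (λ x c → if f x then suc c else c) 0 (allVecs n)
  where open import Data.Bool using (if_then_else_)

𝔼 : ∀ {n} → (Vec Bool n → Bool) → ℚ
𝔼 {n} f = _/_ (+ count f) (2 ^ n) {{m^n≢0 2 n}}

_^ℚ_ : ℚ → ℕ → ℚ
q ^ℚ zero  = 1ℚ
q ^ℚ suc c = q * (q ^ℚ c)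

{-# OPTIONS --safe #-}
module Submission where

-- Idea.  The least acceptance probability over a layer is nonincreasing in the layer, from 𝔼 f down to 0, so some
-- layer k drops it by 𝔼 f / n.  The vertex reached on 0^k is at least as good as the worst vertex of layer k, and
-- making the worst vertex of every later layer reject costs at most the worst probability at layer k + 1; what is
-- left is a program with two live states accepting with probability at least 𝔼 f / n.
--
-- Call a layer in which some edge dies a checkpoint.  Between checkpoints the program is a total two-state automaton,
-- and the event of going from s to τ, of probability p, has a CNF⊕ lower bound (a clause, a conjunction of literals,
-- or a parity) of probability at least p / 2 and at least 1 - 2 (1 - p).  Composing these bounds backwards, choosing
-- one target state at each checkpoint, yields from every state of acceptance probability q a formula of probability
-- at least q^α Z^4, where Z is the largest acceptance probability at the next checkpoint.  This survives the choice
-- because a dying state gains a constant factor 2^α / 8, having q ≤ Z / 2.  All probabilities are kept as counts.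

open import Defs
open import Data.Nat using (ℕ; zero; suc; _+_; _^_; NonZero)
import Data.Nat.Properties as ℕ
open import Data.Bool using (Bool; true; false; not; _∧_; _∨_; _xor_; if_then_else_)
open import Data.Bool.Properties using (∧-assoc; ∧-identityʳ; xor-assoc; xor-comm; not-involutive)
open import Data.Bool.Solver using (module xor-∧-Solver)
open import Data.Fin as Fin using (Fin; zero; suc; _↑ˡ_; _↑ʳ_)
open import Data.Fin.Properties using (↑ˡ-injective; ↑ʳ-injective; splitAt-↑ˡ; splitAt-↑ʳ)
open import Data.Vec as Vec using (Vec; []; _∷_; lookup; replicate; _++_)
open import Data.Vec.Properties using (lookup-++ˡ; lookup-++ʳ; ++-injective)
open import Data.List as List using (List; []; _∷_; map; foldr)
open import Data.List.Properties using (foldr-++; foldr-map)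
open import Data.List.Membership.Propositional using (_∈_)
open import Data.List.Relation.Unary.Any using (here; there)
open import Data.List.Relation.Unary.All as All using (All)
import Data.List.Relation.Unary.All.Properties as All
open import Data.List.Relation.Unary.AllPairs as AllPairs using (AllPairs; []; _∷_)
import Data.List.Relation.Unary.AllPairs.Properties as AllPairs
open import Data.Maybe using (Maybe; just; nothing; maybe′; fromMaybe)
open import Data.Product using (Σ; _×_; ∃; _,_; proj₁; proj₂)
open import Data.Sum using (_⊎_; inj₁; inj₂)
open import Data.Empty using (⊥)
open import Data.Unit using (tt)
import Data.Integer as ℤ
import Data.Integer.Properties as ℤ
open import Data.Rational using (ℚ; toℚᵘ; _/_)
import Data.Rational.Properties as ℚ
open import Data.Rational.Unnormalised using (mkℚᵘ; *≤*) renaming (_≃_ to _≃ᵘ_)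
import Data.Rational.Unnormalised.Properties as ℚᵘ
open import Function using (_∘_; case_of_)
open import Relation.Binary.PropositionalEquality using (_≡_; _≢_; refl; sym; trans; cong; cong₂; subst; subst₂)

module Reduction where
  open import Data.Nat using (_*_; _⊔_; z≤n; s≤s) renaming (_≤_ to _≤ℕ_)
  import Data.Nat as Nat
  open import Data.Nat.Tactic.RingSolver using (solve-∀)
  open import Data.Rational using () renaming (_≤_ to _≤ℚ_; _*_ to _*ℚ_)

  -- Counting satisfying assignments.

  bit : Bool → ℕ
  bit true  = 1
  bit false = 0

  ∑ : ∀ m → (Vec Bool m → ℕ) → ℕ
  ∑ zero    F = F []
  ∑ (suc m) F = ∑ m (F ∘ (false ∷_)) + ∑ m (F ∘ (true ∷_))

  # : ∀ {m} → (Vec Bool m → Bool) → ℕ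
  # {m} f = ∑ m (bit ∘ f)

  ∑-mono : ∀ m {F G : Vec Bool m → ℕ} → (∀ x → F x ≤ℕ G x) → ∑ m F ≤ℕ ∑ m G
  ∑-mono zero    h = h []
  ∑-mono (suc m) h = ℕ.+-mono-≤ (∑-mono m (h ∘ (false ∷_))) (∑-mono m (h ∘ (true ∷_)))

  ∑-cong : ∀ m {F G : Vec Bool m → ℕ} → (∀ x → F x ≡ G x) → ∑ m F ≡ ∑ m G
  ∑-cong zero    h = h []
  ∑-cong (suc m) h = cong₂ _+_ (∑-cong m (h ∘ (false ∷_))) (∑-cong m (h ∘ (true ∷_)))

  ∑-+ : ∀ m (F G : Vec Bool m → ℕ) → ∑ m (λ x → F x + G x) ≡ ∑ m F + ∑ m G
  ∑-+ zero    F G = refl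
  ∑-+ (suc m) F G
    rewrite ∑-+ m (F ∘ (false ∷_)) (G ∘ (false ∷_)) | ∑-+ m (F ∘ (true ∷_)) (G ∘ (true ∷_))
    = interchange (∑ m (F ∘ (false ∷_))) (∑ m (G ∘ (false ∷_))) (∑ m (F ∘ (true ∷_))) (∑ m (G ∘ (true ∷_)))
    where
    interchange : ∀ a b c d → (a + b) + (c + d) ≡ (a + c) + (b + d)
    interchange = solve-∀

  ∑-* : ∀ m k (F : Vec Bool m → ℕ) → ∑ m (λ x → F x * k) ≡ ∑ m F * k
  ∑-* zero    k F = refl
  ∑-* (suc m) k F = trans (cong₂ _+_ (∑-* m k _) (∑-* m k _)) (sym (ℕ.*-distribʳ-+ k (∑ m (F ∘ (false ∷_))) _))

  ∑-++ : ∀ m n (F : Vec Bool (m + n) → ℕ) → ∑ (m + n) F ≡ ∑ m (λ x → ∑ n (λ y → F (x ++ y)))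
  ∑-++ zero    n F = refl
  ∑-++ (suc m) n F = cong₂ _+_ (∑-++ m n (F ∘ (false ∷_))) (∑-++ m n (F ∘ (true ∷_)))

  #-cong : ∀ {m} {f g : Vec Bool m → Bool} → (∀ x → f x ≡ g x) → # f ≡ # g
  #-cong {m} h = ∑-cong m (λ x → cong bit (h x))

  #-true : ∀ m → # {m} (λ _ → true) ≡ 2 ^ m
  #-true zero    = refl
  #-true (suc m) rewrite #-true m = cong (2 ^ m +_) (sym (ℕ.+-identityʳ (2 ^ m)))

  #-false : ∀ m → # {m} (λ _ → false) ≡ 0
  #-false zero    = refl
  #-false (suc m) rewrite #-false m = refl

  #-not : ∀ {m} (f : Vec Bool m → Bool) → # f + # (not ∘ f) ≡ 2 ^ m
  #-not {m} f = trans (sym (∑-+ m (bit ∘ f) (bit ∘ not ∘ f)))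
                      (trans (∑-cong m (λ x → bit-not (f x))) (#-true m))
    where
    bit-not : ∀ b → bit b + bit (not b) ≡ 1
    bit-not true  = refl
    bit-not false = refl

  #≤2^ : ∀ {m} (f : Vec Bool m → Bool) → # f ≤ℕ 2 ^ m
  #≤2^ f = subst (# f ≤ℕ_) (#-not f) (ℕ.m≤m+n (# f) _)

  #-cons : ∀ {m} b (f : Vec Bool (suc m) → Bool) → # f ≡ # (f ∘ (b ∷_)) + # (f ∘ (not b ∷_))
  #-cons false f = refl
  #-cons true  f = ℕ.+-comm (# (f ∘ (false ∷_))) _

  #-snoc : ∀ {m} b (f : Vec Bool (m + 1) → Bool) →
    # f ≡ # (λ x → f (x ++ b ∷ [])) + # (λ x → f (x ++ not b ∷ []))
  #-snoc {m} false f = trans (∑-++ m 1 (bit ∘ f)) (∑-+ m _ _)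
  #-snoc {m} true  f = trans (trans (∑-++ m 1 (bit ∘ f)) (∑-+ m _ _)) (ℕ.+-comm (# (λ x → f (x ++ false ∷ []))) _)

  #-∧ : ∀ {m n} (f : Vec Bool m → Bool) (g : Vec Bool n → Bool) (h : Vec Bool (m + n) → Bool) →
    (∀ x y → h (x ++ y) ≡ f x ∧ g y) → # h ≡ # f * # g
  #-∧ {m} {n} f g h e = trans (∑-++ m n (bit ∘ h)) (trans (∑-cong m row) (∑-* m (# g) (bit ∘ f)))
    where
    row : ∀ x → ∑ n (λ y → bit (h (x ++ y))) ≡ bit (f x) * # g
    row x with f x in fx
    ... | true  = trans (∑-cong n (λ y → cong bit (trans (e x y) (cong (_∧ g y) fx)))) (sym (ℕ.+-identityʳ (# g)))
    ... | false = trans (∑-cong n (λ y → cong bit (trans (e x y) (cong (_∧ g y) fx)))) (#-false n)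

  count≡# : ∀ {n} (f : Vec Bool n → Bool) → count f ≡ # f
  count≡# {n} f = trans (foldr-# n f 0) (ℕ.+-identityʳ (# f))
    where
    -- The start value `k` is general because the fold over the second half of the list becomes the
    -- start value for the first half.
    foldr-# : ∀ n (f : Vec Bool n → Bool) k → foldr (λ x c → if f x then suc c else c) k (allVecs n) ≡ # f + k
    foldr-# zero f k with f []
    ... | true  = refl
    ... | false = refl
    foldr-# (suc n) f k
      rewrite foldr-++ (λ x c → if f x then suc c else c) k (map (false ∷_) (allVecs n)) (map (true ∷_) (allVecs n))
            | foldr-map (λ x c → if f x then suc c else c) (true ∷_) k (allVecs n)
            | foldr-# n (f ∘ (true ∷_)) k
            | foldr-map (λ x c → if f x then suc c else c) (false ∷_) (# (f ∘ (true ∷_)) + k) (allVecs n)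
            | foldr-# n (f ∘ (false ∷_)) (# (f ∘ (true ∷_)) + k)
      = sym (ℕ.+-assoc (# (f ∘ (false ∷_))) (# (f ∘ (true ∷_))) k)

  -- Renaming variables, and conjunctions over disjoint blocks of variables.

  renLit : ∀ {m n} → (Fin m → Fin n) → Literal m → Literal n
  renLit ρ (lit i b) = lit (ρ i) b

  renTerm : ∀ {m n} → (Fin m → Fin n) → Term m → Term n
  renTerm ρ (term k ls) = term k (map (renLit ρ) ls)

  vars : ∀ {m} → List (Literal m) → List (Fin m)
  vars = map Literal.var

  ∈-vars-ren : ∀ {m n} (ρ : Fin m → Fin n) ls {v} → v ∈ vars (map (renLit ρ) ls) → ∃ λ u → u ∈ vars ls × v ≡ ρ u
  ∈-vars-ren ρ (l ∷ ls) (here e)  = Literal.var l , here refl , e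
  ∈-vars-ren ρ (l ∷ ls) (there p) = let u , q , e = ∈-vars-ren ρ ls p in u , there q , e

  Apart : ∀ {m} → Term m → Term m → Set
  Apart T T′ = ∀ v → v ∈ termVars T → v ∈ termVars T′ → ⊥

  apart-ren : ∀ {m n} (ρ : Fin m → Fin n) → (∀ {i j} → ρ i ≡ ρ j → i ≡ j) →
    ∀ {T T′} → Apart T T′ → Apart (renTerm ρ T) (renTerm ρ T′)
  apart-ren ρ inj {T} {T′} d v p q =
    let u , u∈ , e = ∈-vars-ren ρ (Term.lits T) p
        w , w∈ , e′ = ∈-vars-ren ρ (Term.lits T′) q
    in d u u∈ (subst (_∈ termVars T′) (inj (trans (sym e′) e)) w∈)

  ↑ˡ≢↑ʳ : ∀ {m n} (i : Fin m) (j : Fin n) → i ↑ˡ n ≢ m ↑ʳ j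
  ↑ˡ≢↑ʳ {m} {n} i j e with trans (sym (splitAt-↑ˡ m i n)) (trans (cong (Fin.splitAt m) e) (splitAt-↑ʳ m n j))
  ... | ()

  apart-↑ : ∀ {m n} (T : Term m) (T′ : Term n) → Apart (renTerm (_↑ˡ n) T) (renTerm (m ↑ʳ_) T′)
  apart-↑ {m} {n} T T′ v p q =
    let u , _ , e = ∈-vars-ren (_↑ˡ n) (Term.lits T) p
        w , _ , e′ = ∈-vars-ren (m ↑ʳ_) (Term.lits T′) q
    in ↑ˡ≢↑ʳ u w (trans (sym e) e′)

  evalTerms : ∀ {m} → List (Term m) → Vec Bool m → Bool
  evalTerms Ts y = foldr (λ T b → evalTerm T y ∧ b) true Ts

  evalTerms-++ : ∀ {m} (Ts Us : List (Term m)) y → evalTerms (Ts List.++ Us) y ≡ evalTerms Ts y ∧ evalTerms Us y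
  evalTerms-++ []       Us y = refl
  evalTerms-++ (T ∷ Ts) Us y = trans (cong (evalTerm T y ∧_) (evalTerms-++ Ts Us y))
                                     (sym (∧-assoc (evalTerm T y) (evalTerms Ts y) (evalTerms Us y)))

  module _ {m n} (ρ : Fin m → Fin n) (x : Vec Bool n) (y : Vec Bool m) (e : ∀ i → lookup x (ρ i) ≡ lookup y i) where

    evalLit-ren : ∀ l → evalLit (renLit ρ l) x ≡ evalLit l y
    evalLit-ren (lit i true)  = e i
    evalLit-ren (lit i false) = cong not (e i)

    evalTerm-ren : ∀ T → evalTerm (renTerm ρ T) x ≡ evalTerm T y
    evalTerm-ren (term disj [])         = refl
    evalTerm-ren (term disj (l ∷ ls))   = cong₂ _∨_ (evalLit-ren l) (evalTerm-ren (term disj ls))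
    evalTerm-ren (term parity [])       = refl
    evalTerm-ren (term parity (l ∷ ls)) = cong₂ _xor_ (evalLit-ren l) (evalTerm-ren (term parity ls))

    evalTerms-ren : ∀ Ts → evalTerms (map (renTerm ρ) Ts) x ≡ evalTerms Ts y
    evalTerms-ren []       = refl
    evalTerms-ren (T ∷ Ts) = cong₂ _∧_ (evalTerm-ren T) (evalTerms-ren Ts)

  module _ {m n} (x : Vec Bool m) (y : Vec Bool n) where
    evalTerm-ˡ : ∀ T → evalTerm (renTerm (_↑ˡ n) T) (x ++ y) ≡ evalTerm T x
    evalTerm-ˡ = evalTerm-ren (_↑ˡ n) (x ++ y) x (lookup-++ˡ x y)

    evalTerms-ˡ : ∀ Ts → evalTerms (map (renTerm (_↑ˡ n)) Ts) (x ++ y) ≡ evalTerms Ts x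
    evalTerms-ˡ = evalTerms-ren (_↑ˡ n) (x ++ y) x (lookup-++ˡ x y)

    evalTerms-ʳ : ∀ Ts → evalTerms (map (renTerm (m ↑ʳ_)) Ts) (x ++ y) ≡ evalTerms Ts y
    evalTerms-ʳ = evalTerms-ren (m ↑ʳ_) (x ++ y) y (lookup-++ʳ x y)

  -- Terms from different factors share no variable because the two injections into `Fin (m + n)`
  -- have disjoint ranges.
  _⊗_ : ∀ {m n} → CNF⊕ m → CNF⊕ n → CNF⊕ (m + n)
  _⊗_ {m} {n} (cnf⊕ Ts d) (cnf⊕ Us d′) = cnf⊕ (map (renTerm (_↑ˡ n)) Ts List.++ map (renTerm (m ↑ʳ_)) Us)
    (AllPairs.++⁺ (AllPairs.map⁺ (AllPairs.map (λ {T} {T′} → apart-ren (_↑ˡ n) (↑ˡ-injective n _ _) {T} {T′}) d))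
                  (AllPairs.map⁺ (AllPairs.map (λ {T} {T′} → apart-ren (m ↑ʳ_) (↑ʳ-injective m _ _) {T} {T′}) d′))
                  (All.map⁺ (All.universal (λ T → All.map⁺ (All.universal (λ T′ → apart-↑ T T′) Us)) Ts)))

  eval-⊗ : ∀ {m n} (φ : CNF⊕ m) (ψ : CNF⊕ n) x y → evalCNF⊕ (φ ⊗ ψ) (x ++ y) ≡ evalCNF⊕ φ x ∧ evalCNF⊕ ψ y
  eval-⊗ {m} {n} (cnf⊕ Ts _) (cnf⊕ Us _) x y =
    trans (evalTerms-++ (map (renTerm (_↑ˡ n)) Ts) _ (x ++ y)) (cong₂ _∧_ (evalTerms-ˡ x y Ts) (evalTerms-ʳ x y Us))

  -- Lower bounds by formulas.

  record Ach {m} (f : Vec Bool m → Bool) (c : ℕ) : Set where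
    constructor ach
    field
      formula : CNF⊕ m
      sound   : ∀ y → evalCNF⊕ formula y ≡ true → f y ≡ true
      size    : c ≤ℕ # (evalCNF⊕ formula)

  ∧-true : ∀ {a b} → a ∧ b ≡ true → a ≡ true × b ≡ true
  ∧-true {true} {true} refl = refl , refl

  -- The composition rule. It is applied with `f` the event of reaching a state and `g` acceptance
  -- from that state; by independence the counts multiply.
  ach-⊗ : ∀ {m n} {f : Vec Bool m → Bool} {g : Vec Bool n → Bool} {h : Vec Bool (m + n) → Bool} {c d} →
    (∀ x y → f x ≡ true → g y ≡ true → h (x ++ y) ≡ true) → Ach f c → Ach g d → Ach h (c * d)
  ach-⊗ {m} {n} {h = h} {c} {d} fg⇒h (ach φ s z) (ach ψ s′ z′) = ach (φ ⊗ ψ) sound size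
    where
    sound : ∀ y → evalCNF⊕ (φ ⊗ ψ) y ≡ true → h y ≡ true
    sound w e with Vec.splitAt m w
    ... | x , y , refl with ∧-true {evalCNF⊕ φ x} (trans (sym (eval-⊗ φ ψ x y)) e)
    ...   | p , q = fg⇒h x y (s x p) (s′ y q)
    size : c * d ≤ℕ # (evalCNF⊕ (φ ⊗ ψ))
    size rewrite #-∧ (evalCNF⊕ φ) (evalCNF⊕ ψ) (evalCNF⊕ (φ ⊗ ψ)) (eval-⊗ φ ψ) = ℕ.*-mono-≤ z z′

  single : ∀ {m} → Term m → CNF⊕ m
  single T = cnf⊕ (T ∷ []) (All.[] ∷ [])

  ach-zero : ∀ {m} {f : Vec Bool m → Bool} → Ach f 0
  -- The empty disjunction is the constant false.
  ach-zero = ach (single (term disj [])) (λ _ ()) z≤n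

  ach-true : ∀ {m} {f : Vec Bool m → Bool} → (∀ y → f y ≡ true) → Ach f (2 ^ m)
  ach-true {m} h = ach (cnf⊕ [] []) (λ y _ → h y) (ℕ.≤-reflexive (sym (#-true m)))

  single-true : ∀ {m} (T : Term m) y → evalCNF⊕ (single T) y ≡ evalTerm T y
  single-true T y = ∧-identityʳ (evalTerm T y)

  is : Bool → Vec Bool 1 → Bool
  is β (b ∷ []) = not (β xor b)

  is-refl : ∀ β → is β (β ∷ []) ≡ true
  is-refl true  = refl
  is-refl false = refl

  is-sound : ∀ β b → is β (b ∷ []) ≡ true → b ≡ β
  is-sound true  true  _ = refl
  is-sound false false _ = refl

  ach-bit : ∀ β → Ach (is β) 1
  ach-bit true  = ach (single (term disj (lit zero true ∷ [])))  (λ { (true ∷ []) _ → refl ; (false ∷ []) () }) ℕ.≤-refl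
  ach-bit false = ach (single (term disj (lit zero false ∷ []))) (λ { (false ∷ []) _ → refl ; (true ∷ []) () }) ℕ.≤-refl

  -- Total two-state automata.

  -- Segments grow at the end, since the last layers decide how likely a final state is.
  data Seg : ℕ → Set where
    []  : Seg 0
    _▹_ : ∀ {m} → Seg m → (Bool → Bool → Bool) → Seg (m + 1)

  evalSeg : ∀ {m} → Seg m → Vec Bool m → Bool → Bool
  evalSeg []            x s = s
  evalSeg (_▹_ {m} t l) x s = let y , z , _ = Vec.splitAt m x in l (Vec.head z) (evalSeg t y s)

  evalSeg-▹ : ∀ {m} (t : Seg m) l y b s → evalSeg (t ▹ l) (y ++ b ∷ []) s ≡ l b (evalSeg t y s)
  evalSeg-▹ {m} t l y b s with Vec.splitAt m (y ++ b ∷ [])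
  ... | y′ , z′ , e with ++-injective y y′ e
  ...   | refl , refl = refl

  -- Programs are processed from their last layer to their first, so new layers arrive at the front
  -- of a segment.
  cons : ∀ {m} → (Bool → Bool → Bool) → Seg m → Seg (suc m)
  cons l []      = [] ▹ l
  cons l (t ▹ k) = cons l t ▹ k

  evalSeg-cons : ∀ {m} l (t : Seg m) b x s → evalSeg (cons l t) (b ∷ x) s ≡ evalSeg t x (l b s)
  evalSeg-cons l []            b [] s = refl
  evalSeg-cons l (_▹_ {m} t k) b x  s = cong (k _) (evalSeg-cons l t b (proj₁ (Vec.splitAt m x)) s)

  -- The four self-maps of a two-element set are two resets and two permutations, and the
  -- permutations are translations.
  data Unary (u : Bool → Bool) : Set where
    const : ∀ c → (∀ σ → u σ ≡ c) → Unary u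
    shift : ∀ c → (∀ σ → u σ ≡ σ xor c) → Unary u

  unary : ∀ u → Unary u
  unary u with u false in p | u true in q
  ... | false | false = const false λ { false → p ; true → q }
  ... | true  | true  = const true  λ { false → p ; true → q }
  ... | false | true  = shift false λ { false → p ; true → q }
  ... | true  | false = shift true  λ { false → p ; true → q }

  -- guard forces the last reset of a segment; the bits after it act on the state by an affine map.
  record Affine {m} (e : Vec Bool m → Bool) : Set where
    field
      guard  : CNF⊕ m
      lits   : List (Literal m)
      offset : Bool
      apart  : All (λ T → Apart (term parity lits) T) (CNF⊕.terms guard)
      half   : 2 ^ m ≤ℕ 2 * # (evalCNF⊕ guard)
      agrees : ∀ y → evalCNF⊕ guard y ≡ true → e y ≡ evalTerm (term parity lits) y xor offset

  top : ∀ {m} → CNF⊕ m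
  top = cnf⊕ [] []

  var : ∀ {m} → Fin (m + 1)
  var {m} = m ↑ʳ zero

  lookup-var : ∀ {m} (y : Vec Bool m) b → lookup (y ++ b ∷ []) var ≡ b
  lookup-var y b = lookup-++ʳ y (b ∷ []) zero

  raise : ∀ {m} → List (Literal m) → List (Literal (m + 1))
  raise = map (renLit (_↑ˡ 1))

  last-bit : ∀ {m} → Bool → CNF⊕ (m + 1)
  last-bit {m} β = top {m} ⊗ single (term disj (lit zero β ∷ []))

  eval-last-bit : ∀ {m} β (y : Vec Bool m) b → evalCNF⊕ (last-bit β) (y ++ b ∷ []) ≡ is β (b ∷ [])
  eval-last-bit β y b = trans (eval-⊗ top (single (term disj (lit zero β ∷ []))) y (b ∷ [])) (lemma β b)
    where
    lemma : ∀ β b → true ∧ evalCNF⊕ (single (term disj (lit zero β ∷ []))) (b ∷ []) ≡ is β (b ∷ [])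
    lemma true  true  = refl
    lemma true  false = refl
    lemma false true  = refl
    lemma false false = refl

  #-is : ∀ β → # (is β) ≡ 1
  #-is true  = refl
  #-is false = refl

  #-last-bit : ∀ {m} β → # (evalCNF⊕ (last-bit {m} β)) ≡ 2 ^ m
  #-last-bit {m} β = trans (#-∧ {m} (λ _ → true) (is β) _ (λ { x (b ∷ []) → eval-last-bit β x b }))
    (trans (cong₂ _*_ (#-true m) (#-is β)) (ℕ.*-identityʳ (2 ^ m)))

  2^[m+1] : ∀ m → 2 ^ (m + 1) ≡ 2 * 2 ^ m
  2^[m+1] m = cong (2 ^_) (ℕ.+-comm m 1)

  by-snoc : ∀ {m} {P : Vec Bool (m + 1) → Set} → (∀ y b → P (y ++ b ∷ [])) → ∀ x → P x
  by-snoc {m} h x with Vec.splitAt m x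
  ... | y , b ∷ [] , refl = h y b

  affine-[] : ∀ s → Affine {0} (λ _ → s)
  affine-[] s = record { guard = top ; lits = [] ; offset = s ; apart = All.[] ; half = s≤s z≤n ; agrees = λ _ _ → refl }

  -- Requiring the resetting letter, one literal of probability 1/2, erases all dependence on
  -- earlier bits, so the parity is empty.
  affine-reset : ∀ {m} {f : Vec Bool (m + 1) → Bool} β c → (∀ y → f (y ++ β ∷ []) ≡ c) → Affine f
  affine-reset {m} {f} β c h = record
    { guard  = last-bit β
    ; lits   = []
    ; offset = c
    ; apart  = All.universal (λ _ _ ()) _
    ; half   = ℕ.≤-reflexive (trans (2^[m+1] m) (cong (2 *_) (sym (#-last-bit {m} β))))
    ; agrees = by-snoc λ y b t → trans (cong (λ z → f (y ++ z ∷ [])) (is-sound β b (trans (sym (eval-last-bit β y b)) t))) (h y)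
    }

  raise-apart : ∀ {m} (Ts : List (Term m)) ls →
    All (λ T → Apart (term parity ls) T) Ts → All (λ T → Apart (term parity (raise ls)) T) (map (renTerm (_↑ˡ 1)) Ts List.++ [])
  raise-apart Ts ls a = All.++⁺ (All.map⁺ (All.map (λ {T} → apart-ren (_↑ˡ 1) (↑ˡ-injective 1 _ _) {term parity ls} {T}) a)) All.[]

  raise-apart-var : ∀ {m} (Ts : List (Term m)) p ls →
    All (λ T → Apart (term parity ls) T) Ts →
    All (λ T → Apart (term parity (lit var p ∷ raise ls)) T) (map (renTerm (_↑ˡ 1)) Ts List.++ [])
  raise-apart-var {m} Ts p ls a = All.++⁺ (All.map⁺ (All.map (λ {T} → step′ {T}) a)) All.[]
    where
    step′ : ∀ {T} → Apart (term parity ls) T → Apart (term parity (lit var p ∷ raise ls)) (renTerm (_↑ˡ 1) T)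
    step′ {T} d v (here refl) q = let u , _ , e = ∈-vars-ren (_↑ˡ 1) (Term.lits T) q in ↑ˡ≢↑ʳ u zero (sym e)
    step′ {T} d v (there r)   q = apart-ren (_↑ˡ 1) (↑ˡ-injective 1 _ _) {term parity ls} {T} d v r q

  #-raise : ∀ {m} (φ : CNF⊕ m) → # (evalCNF⊕ (φ ⊗ top {1})) ≡ # (evalCNF⊕ φ) * 2
  #-raise φ = #-∧ (evalCNF⊕ φ) (λ _ → true) _ (eval-⊗ φ top)

  raise-true : ∀ {m} (φ : CNF⊕ m) y z → evalCNF⊕ (φ ⊗ top {1}) (y ++ z) ≡ true → evalCNF⊕ φ y ≡ true
  raise-true φ y z e = proj₁ (∧-true (trans (sym (eval-⊗ φ top y z)) e))

  half-raise : ∀ {m} (φ : CNF⊕ m) → 2 ^ m ≤ℕ 2 * # (evalCNF⊕ φ) → 2 ^ (m + 1) ≤ℕ 2 * # (evalCNF⊕ (φ ⊗ top {1}))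
  half-raise {m} φ h rewrite 2^[m+1] m | #-raise φ | ℕ.*-comm (# (evalCNF⊕ φ)) 2 = ℕ.*-monoʳ-≤ 2 h

  affine-shift : ∀ {m} {e : Vec Bool m → Bool} {f : Vec Bool (m + 1) → Bool} c →
    (∀ y b → f (y ++ b ∷ []) ≡ e y xor c) → Affine e → Affine f
  affine-shift {f = f} c h A = record
    { guard  = guard ⊗ top
    ; lits   = raise lits
    ; offset = offset xor c
    ; apart  = raise-apart _ lits apart
    ; half   = half-raise guard half
    ; agrees = by-snoc λ y b t → trans (h y b) (trans (cong (_xor c) (agrees y (raise-true guard y _ t)))
        (trans (xor-assoc (evalTerm (term parity lits) y) offset c)
               (cong (_xor (offset xor c)) (sym (evalTerm-ˡ y (b ∷ []) (term parity lits))))))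
    }
    where open Affine A

  -- The two letters act by different translations, so the last bit itself joins the parity.
  affine-parity : ∀ {m} {e : Vec Bool m → Bool} {f : Vec Bool (m + 1) → Bool} c →
    (∀ y b → f (y ++ b ∷ []) ≡ e y xor (b xor c)) → Affine e → Affine f
  affine-parity {f = f} c h A = record
    { guard  = guard ⊗ top
    ; lits   = lit var true ∷ raise lits
    ; offset = offset xor c
    ; apart  = raise-apart-var _ true lits apart
    ; half   = half-raise guard half
    ; agrees = by-snoc λ y b t → trans (h y b) (trans (cong (_xor (b xor c)) (agrees y (raise-true guard y _ t)))
        (trans (rearrange (evalTerm (term parity lits) y) offset b c)
               (cong₂ (λ p q → (p xor q) xor (offset xor c)) (sym (lookup-var y b))
                 (sym (evalTerm-ˡ y (b ∷ []) (term parity lits))))))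
    }
    where
    open Affine A
    rearrange : ∀ p o b c → (p xor o) xor (b xor c) ≡ (b xor p) xor (o xor c)
    rearrange = solve 4 (λ p o b c → (p :+ o) :+ (b :+ c) := (b :+ p) :+ (o :+ c)) refl
      where open xor-∧-Solver

  shifts : ∀ c d → (c ≡ d) ⊎ (not c ≡ d)
  shifts true  true  = inj₁ refl
  shifts true  false = inj₂ refl
  shifts false true  = inj₂ refl
  shifts false false = inj₁ refl

  -- Read from the end, both letters of each layer translate until a layer with a resetting letter
  -- is met, and the recursion stops there.
  affine-seg : ∀ {m} (t : Seg m) s → Affine (λ x → evalSeg t x s)
  affine-seg []      s = affine-[] s
  affine-seg (t ▹ l) s with unary (l false) | unary (l true)
  ... | const c h | _         = affine-reset false c (λ y → trans (evalSeg-▹ t l y false s) (h _))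
  ... | shift _ _ | const c h = affine-reset true  c (λ y → trans (evalSeg-▹ t l y true s) (h _))
  ... | shift c h | shift d k with shifts c d
  ...   | inj₁ refl = affine-shift c (λ { y false → trans (evalSeg-▹ t l y false s) (h _)
                                        ; y true  → trans (evalSeg-▹ t l y true  s) (k _) }) (affine-seg t s)
  ...   | inj₂ refl = affine-parity c (λ { y false → trans (evalSeg-▹ t l y false s) (h _)
                                         ; y true  → trans (evalSeg-▹ t l y true  s) (k _) }) (affine-seg t s)

  -- Each assignment satisfying the guard extends by exactly one value of the last bit, so the count is that of the guard.
  ach-parity : ∀ {m} {e : Vec Bool m → Bool} {f : Vec Bool (m + 1) → Bool} c →
    (∀ y b → f (y ++ b ∷ []) ≡ e y xor (b xor c)) → (A : Affine e) → Ach f (# (evalCNF⊕ (Affine.guard A)))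
  ach-parity {m} {e} {f} c h A = ach φ (by-snoc sound) size
    where
    open Affine A
    T : Term (m + 1)
    -- A parity term has no constant, so `offset xor c` goes into the sign of the new literal.
    T = term parity (lit var (not (offset xor c)) ∷ raise lits)
    φ : CNF⊕ (m + 1)
    φ = cnf⊕ (T ∷ CNF⊕.terms (guard ⊗ top {1})) (raise-apart-var (CNF⊕.terms guard) (not (offset xor c)) lits apart ∷ CNF⊕.disjoint (guard ⊗ top {1}))
    par : Vec Bool m → Bool
    par = evalTerm (term parity lits)
    eval-T : ∀ y b → evalTerm T (y ++ b ∷ []) ≡ (b xor (offset xor c)) xor par y
    eval-T y b = cong₂ _xor_ (eval-lit (offset xor c)) (evalTerm-ˡ y (b ∷ []) (term parity lits))
      where
      eval-lit : ∀ d → evalLit (lit var (not d)) (y ++ b ∷ []) ≡ b xor d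
      eval-lit true  = trans (cong not (lookup-var y b)) (xor-comm true b)
      eval-lit false = trans (lookup-var y b) (xor-comm false b)
    eval-φ : ∀ y b → evalCNF⊕ φ (y ++ b ∷ []) ≡ ((b xor (offset xor c)) xor par y) ∧ evalCNF⊕ guard y
    eval-φ y b = cong₂ _∧_ (eval-T y b) (trans (eval-⊗ guard top y (b ∷ [])) (∧-identityʳ (evalCNF⊕ guard y)))
    rearrange : ∀ p o b c → (b xor (o xor c)) xor p ≡ (p xor o) xor (b xor c)
    rearrange = solve 4 (λ p o b c → (b :+ (o :+ c)) :+ p := (p :+ o) :+ (b :+ c)) refl
      where open xor-∧-Solver
    sound : ∀ y b → evalCNF⊕ φ (y ++ b ∷ []) ≡ true → f (y ++ b ∷ []) ≡ true
    sound y b t with ∧-true (trans (sym (eval-φ y b)) t)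
    ... | p , q = trans (h y b) (trans (cong (_xor (b xor c)) (agrees y q)) (trans (sym (rearrange (par y) offset b c)) p))
    one-bit : ∀ d p g → bit g ≤ℕ bit (((false xor d) xor p) ∧ g) + bit (((true xor d) xor p) ∧ g)
    one-bit d     p     false = z≤n
    one-bit true  true  true  = ℕ.≤-refl
    one-bit true  false true  = ℕ.≤-refl
    one-bit false true  true  = ℕ.≤-refl
    one-bit false false true  = ℕ.≤-refl
    size : # (evalCNF⊕ guard) ≤ℕ # (evalCNF⊕ φ)
    size = ℕ.≤-trans (∑-mono m (λ y → ℕ.≤-trans (one-bit (offset xor c) (par y) (evalCNF⊕ guard y))
               (ℕ.≤-reflexive (cong₂ (λ p q → bit p + bit q) (sym (eval-φ y false)) (sym (eval-φ y true))))))
             (ℕ.≤-reflexive (sym (trans (#-snoc {m} false (evalCNF⊕ φ)) (sym (∑-+ m _ _)))))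

  -- Approximating the event of ending a segment in a given state.

  -- In the case clause the remaining program has probability at most 1/2, so dropping it at most doubles the
  -- failure probability.
  data Approx {m} (f : Vec Bool m → Bool) : Set where
    full   : (∀ x → f x ≡ true) → Approx f
    clause : ∀ ls → (∀ y → evalTerm (term disj ls) y ≡ true → f y ≡ true) →
             2 ^ m ≤ℕ 2 * # (evalTerm (term disj ls)) → 2 * # f ≤ℕ # (evalTerm (term disj ls)) + 2 ^ m → Approx f
    low    : ∀ γ → Ach f γ → # f ≤ℕ 2 * γ → 2 * # f ≤ℕ 2 ^ m → Approx f

  -- In probabilities, γ ≥ p / 2 and γ ≥ 2p - 1. A clause meets the first bound because it has
  -- probability at least 1/2; in the case `low` the second is trivial because p ≤ 1/2.
  approx-ach : ∀ {m} {f : Vec Bool m → Bool} → Approx f → ∃ λ γ → Ach f γ × # f ≤ℕ 2 * γ × 2 * # f ≤ℕ γ + 2 ^ m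
  approx-ach {m} {f} (full h) = 2 ^ m , ach-true h , ℕ.≤-trans (#≤2^ f) (ℕ.m≤m+n _ _) ,
    ℕ.≤-trans (ℕ.*-monoʳ-≤ 2 (#≤2^ f)) (ℕ.≤-reflexive (cong (2 ^ m +_) (ℕ.+-identityʳ (2 ^ m))))
  approx-ach {m} {f} (clause ls h p q) = # (evalTerm T) ,
    ach (single T) (λ y → h y ∘ trans (sym (single-true T y))) (ℕ.≤-reflexive (#-cong (λ y → sym (single-true T y)))) ,
    ℕ.≤-trans (#≤2^ f) p , q
    where T = term disj ls
  approx-ach {m} (low γ a p q) = γ , a , p , ℕ.≤-trans q (ℕ.m≤n+m _ γ)

  module _ {m} {f : Vec Bool (m + 1) → Bool} where

    by-bit : ∀ β {P : Vec Bool (m + 1) → Set} → (∀ y → P (y ++ β ∷ [])) → (∀ y → P (y ++ not β ∷ [])) → ∀ x → P x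
    by-bit false h k = by-snoc λ { y false → h y ; y true → k y }
    by-bit true  h k = by-snoc λ { y false → k y ; y true → h y }

    approx-const : ∀ c → (∀ x → f x ≡ c) → Approx f
    approx-const true  h = full h
    approx-const false h = low 0 ach-zero (ℕ.≤-reflexive z) (ℕ.≤-trans (ℕ.≤-reflexive (cong (2 *_) z)) z≤n)
      where z = trans (#-cong h) (#-false (m + 1))

    -- Adding a literal on a new bit halves the failure probability of the event and of the clause
    -- alike, so the ratio of at most 2 persists.
    or-clause : ∀ β {f′ : Vec Bool m → Bool} → (∀ y → f (y ++ β ∷ []) ≡ true) → (∀ y → f (y ++ not β ∷ []) ≡ f′ y) →
      ∀ ls → (∀ y → evalTerm (term disj ls) y ≡ true → f′ y ≡ true) →
      2 * # f′ ≤ℕ # (evalTerm (term disj ls)) + 2 ^ m → Approx f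
    or-clause β {f′} h k ls s q = clause ls′ (by-bit β {λ x → evalTerm T′ x ≡ true → f x ≡ true}
        (λ y _ → h y) (λ y t → trans (k y) (s y (trans (sym (eval-not y)) t)))) large close
      where
      ls′ = lit var β ∷ raise ls
      T′ = term disj ls′
      T = term disj ls
      eval-lit : ∀ β y b → evalLit (lit (var {m}) β) (y ++ b ∷ []) ≡ is β (b ∷ [])
      eval-lit true  y b = trans (lookup-var y b) (sym (not-involutive b))
      eval-lit false y b = cong not (lookup-var y b)
      is-not : ∀ β → is β (not β ∷ []) ≡ false
      is-not true  = refl
      is-not false = refl
      eval-yes : ∀ y → evalTerm T′ (y ++ β ∷ []) ≡ true
      eval-yes y rewrite eval-lit β y β | is-refl β = refl
      eval-not : ∀ y → evalTerm T′ (y ++ not β ∷ []) ≡ evalTerm T y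
      eval-not y rewrite eval-lit β y (not β) | is-not β = evalTerm-ˡ y (not β ∷ []) T
      #T′ : # (evalTerm T′) ≡ 2 ^ m + # (evalTerm T)
      #T′ = trans (#-snoc {m} β (evalTerm T′)) (cong₂ _+_ (trans (#-cong eval-yes) (#-true m)) (#-cong eval-not))
      #f : # f ≡ 2 ^ m + # f′
      #f = trans (#-snoc {m} β f) (cong₂ _+_ (trans (#-cong h) (#-true m)) (#-cong k))
      large : 2 ^ (m + 1) ≤ℕ 2 * # (evalTerm T′)
      large rewrite 2^[m+1] m | #T′ = ℕ.*-monoʳ-≤ 2 (ℕ.m≤m+n (2 ^ m) _)
      close : 2 * # f ≤ℕ # (evalTerm T′) + 2 ^ (m + 1)
      close rewrite 2^[m+1] m | #T′ | #f = ℕ.≤-trans (ℕ.≤-reflexive (lhs (2 ^ m) (# f′)))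
          (ℕ.≤-trans (ℕ.+-monoˡ-≤ (2 * 2 ^ m) q) (ℕ.≤-reflexive (rhs (2 ^ m) (# (evalTerm T)))))
        where
        lhs : ∀ w p → 2 * (w + p) ≡ 2 * p + 2 * w
        lhs = solve-∀
        rhs : ∀ w c → c + w + 2 * w ≡ w + c + 2 * w
        rhs = solve-∀

    approx-or : ∀ β {f′ : Vec Bool m → Bool} → (∀ y → f (y ++ β ∷ []) ≡ true) → (∀ y → f (y ++ not β ∷ []) ≡ f′ y) →
      Approx f′ → Approx f
    approx-or β h k (full e)          = full (by-bit β {λ x → f x ≡ true} h (λ y → trans (k y) (e y)))
    approx-or β h k (clause ls s _ q) = or-clause β h k ls s q
    -- An event of probability at most 1/2 may be replaced by the empty clause: failure 1 is at most
    -- twice its own failure.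
    approx-or β h k (low _ _ _ q)     = or-clause β h k [] (λ _ ()) (ℕ.≤-trans q (ℕ.≤-reflexive (cong (_+ 2 ^ m) (sym (#-false m)))))

    -- Conjunction with a literal brings the probability to at most 1/2 and keeps the factor 2
    -- between event and formula.
    approx-and : ∀ β {f′ : Vec Bool m → Bool} → (∀ y → f (y ++ β ∷ []) ≡ f′ y) → (∀ y → f (y ++ not β ∷ []) ≡ false) →
      Approx f′ → Approx f
    approx-and β {f′} h k A with approx-ach A
    ... | γ , a , p , _ = low (γ * 1)
        (ach-⊗ (λ { y (b ∷ []) t u → trans (cong (λ z → f (y ++ z ∷ [])) (is-sound β b u)) (trans (h y) t) }) a (ach-bit β))
        (subst (_≤ℕ 2 * (γ * 1)) (sym #f) (subst (λ z → # f′ ≤ℕ 2 * z) (sym (ℕ.*-identityʳ γ)) p))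
        (subst (λ z → 2 * z ≤ℕ 2 ^ (m + 1)) (sym #f) (subst (2 * # f′ ≤ℕ_) (sym (2^[m+1] m)) (ℕ.*-monoʳ-≤ 2 (#≤2^ f′))))
      where
      #f : # f ≡ # f′
      #f = trans (#-snoc {m} β f) (trans (cong₂ _+_ (#-cong h) (trans (#-cong k) (#-false m))) (ℕ.+-identityʳ _))

    approx-skip : ∀ {f′ : Vec Bool m → Bool} → (∀ y b → f (y ++ b ∷ []) ≡ f′ y) → Approx f′ → Approx f
    approx-skip {f′} h = λ where
        (full e)          → full (by-snoc λ y b → trans (h y b) (e y))
        (clause ls s p q) → clause (raise ls)
          (by-snoc λ y b t → trans (h y b) (s y (trans (sym (evalTerm-ˡ y (b ∷ []) (term disj ls))) t)))
          (bound₁ ls p) (bound₂ ls q)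
        (low γ a p q)     → low (γ * 2) (ach-⊗ {g = λ _ → true} (λ { y (b ∷ []) t _ → trans (h y b) t }) a (ach-true (λ _ → refl)))
          (subst₂ _≤ℕ_ (sym #f) (rhs γ) (ℕ.*-monoʳ-≤ 2 p)) (subst₂ (λ a b → 2 * a ≤ℕ b) (sym #f) (sym (2^[m+1] m)) (ℕ.*-monoʳ-≤ 2 q))
      where
      double : ∀ (g : Vec Bool (m + 1) → Bool) {g′ : Vec Bool m → Bool} → (∀ y b → g (y ++ b ∷ []) ≡ g′ y) → # g ≡ 2 * # g′
      double g e = trans (#-snoc {m} false g)
        (cong₂ _+_ (#-cong (λ y → e y false)) (trans (#-cong (λ y → e y true)) (sym (ℕ.+-identityʳ _))))
      #f : # f ≡ 2 * # f′
      #f = double f h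
      #raise : ∀ ls → # (evalTerm (term disj (raise ls))) ≡ 2 * # (evalTerm (term disj ls))
      #raise ls = double _ (λ y b → evalTerm-ˡ y (b ∷ []) (term disj ls))
      rhs : ∀ γ → 2 * (2 * γ) ≡ 2 * (γ * 2)
      rhs = solve-∀
      bound₁ : ∀ ls → 2 ^ m ≤ℕ 2 * # (evalTerm (term disj ls)) → 2 ^ (m + 1) ≤ℕ 2 * # (evalTerm (term disj (raise ls)))
      bound₁ ls p rewrite 2^[m+1] m | #raise ls = ℕ.*-monoʳ-≤ 2 p
      bound₂ : ∀ ls → 2 * # f′ ≤ℕ # (evalTerm (term disj ls)) + 2 ^ m → 2 * # f ≤ℕ # (evalTerm (term disj (raise ls))) + 2 ^ (m + 1)
      bound₂ ls q rewrite 2^[m+1] m | #raise ls | #f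
        = ℕ.≤-trans (ℕ.*-monoʳ-≤ 2 q) (ℕ.≤-reflexive (ℕ.*-distribˡ-+ 2 (# (evalTerm (term disj ls))) (2 ^ m)))

    -- Flipping the last bit flips `f`, so its probability is exactly 1/2, while the guarded parity
    -- keeps at least 1/4.
    approx-parity : ∀ {e : Vec Bool m → Bool} c → (∀ y b → f (y ++ b ∷ []) ≡ e y xor (b xor c)) → Affine e → Approx f
    approx-parity {e} c h A = low _ (ach-parity c h A)
        (subst (_≤ℕ 2 * # (evalCNF⊕ (Affine.guard A))) (sym #f) (Affine.half A))
        (ℕ.≤-reflexive (trans (cong (2 *_) #f) (sym (2^[m+1] m))))
      where
      #f : # f ≡ 2 ^ m
      #f = trans (#-snoc {m} false f)
        (trans (cong₂ _+_ (#-cong (λ y → h y false)) (#-cong (λ y → trans (h y true) (xor-not (e y) c)))) (#-not (λ y → e y xor c)))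
        where
        xor-not : ∀ a c → a xor not c ≡ not (a xor c)
        xor-not true  c = refl
        xor-not false c = refl

  -- With `c = not τ` this is the event of ending in `τ`. A general `c` lets the recursion absorb a
  -- translation made by the last layer.
  approx-seg : ∀ {m} (t : Seg m) s c → Approx (λ x → evalSeg t x s xor c)
  approx-seg []      s c with s xor c
  ... | true  = full (λ _ → refl)
  ... | false = low 0 ach-zero z≤n z≤n
  approx-seg (t ▹ l) s c = go (unary (λ σ → l false σ xor c)) (unary (λ σ → l true σ xor c))
    where
    at : ∀ b {d : Bool → Bool} → (∀ σ → l b σ xor c ≡ d σ) → ∀ y → evalSeg (t ▹ l) (y ++ b ∷ []) s xor c ≡ d (evalSeg t y s)
    at b h y = trans (cong (_xor c) (evalSeg-▹ t l y b s)) (h _)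
    go : Unary (λ σ → l false σ xor c) → Unary (λ σ → l true σ xor c) → Approx (λ x → evalSeg (t ▹ l) x s xor c)
    go (const true h)  (const true k)  = full (by-snoc λ { y false → at false h y ; y true → at true k y })
    go (const true h)  (const false k) = approx-and false (at false h) (at true k) (full (λ _ → refl))
    go (const false h) (const true k)  = approx-and true (at true k) (at false h) (full (λ _ → refl))
    go (const false h) (const false k) = approx-const false (by-snoc λ { y false → at false h y ; y true → at true k y })
    go (const true h)  (shift d k)     = approx-or false (at false h) (at true k) (approx-seg t s d)
    go (const false h) (shift d k)     = approx-and true (at true k) (at false h) (approx-seg t s d)
    go (shift d h)     (const true k)  = approx-or true (at true k) (at false h) (approx-seg t s d)
    go (shift d h)     (const false k) = approx-and false (at false h) (at true k) (approx-seg t s d)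
    go (shift d h)     (shift d′ k) with shifts d d′
    ... | inj₁ refl = approx-skip (λ { y false → at false h y ; y true → at true k y }) (approx-seg t s d)
    ... | inj₂ refl = approx-parity d (λ { y false → at false h y ; y true → at true k y }) (affine-seg t s)

  ach-seg : ∀ {m} (t : Seg m) s c → let f = λ x → evalSeg t x s xor c in
    ∃ λ γ → Ach f γ × # f ≤ℕ 2 * γ × 2 * # f ≤ℕ γ + 2 ^ m
  ach-seg t s c = approx-ach (approx-seg t s c)

  -- Elementary inequalities.

  -- Certificates without subtraction: b - a = q - p is left as an identity for the ring solver.
  ≤-by : ∀ {a b p q} → p ≤ℕ q → a + q ≡ b + p → a ≤ℕ b
  ≤-by {a} {b} {p} {q} p≤q e = ℕ.+-cancelʳ-≤ q a b (ℕ.≤-trans (ℕ.≤-reflexive e) (ℕ.+-monoʳ-≤ b p≤q))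

  -- The two sides differ by (y - x)(Y - X).
  chebyshev-sum : ∀ {x y X Y} → x ≤ℕ y → X ≤ℕ Y → x * Y + y * X ≤ℕ x * X + y * Y
  chebyshev-sum {x} {y} {X} {Y} h k with ℕ.m≤n⇒∃[o]m+o≡n h | ℕ.m≤n⇒∃[o]m+o≡n k
  ... | p , refl | q , refl = ℕ.≤-trans (ℕ.m≤m+n _ (p * q)) (ℕ.≤-reflexive (identity x p X q))
    where
    identity : ∀ x p X q → x * (X + q) + (x + p) * X + p * q ≡ x * X + (x + p) * (X + q)
    identity = solve-∀

  -- Convexity of the power function with weights `w` and `v`, cleared of denominators. The
  -- induction step is Chebyshev's inequality, since a number and its power are ordered alike.
  jensen : ∀ n w v x y → (w * x + v * y) ^ suc n ≤ℕ (w + v) ^ n * (w * x ^ suc n + v * y ^ suc n)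
  jensen zero    w v x y = ℕ.≤-reflexive (base w v x y)
    where
    base : ∀ w v x y → (w * x + v * y) * 1 ≡ 1 * (w * (x * 1) + v * (y * 1))
    base = solve-∀
  jensen (suc n) w v x y = begin
    N * N ^ suc n                                             ≤⟨ ℕ.*-monoʳ-≤ N (jensen n w v x y) ⟩
    N * ((w + v) ^ n * (w * x ^ suc n + v * y ^ suc n))       ≡⟨ swap N ((w + v) ^ n) _ ⟩
    (w + v) ^ n * (N * (w * x ^ suc n + v * y ^ suc n))       ≤⟨ ℕ.*-monoʳ-≤ ((w + v) ^ n) (expand (x ^ suc n) (y ^ suc n) mono) ⟩
    (w + v) ^ n * ((w + v) * (w * x ^ suc (suc n) + v * y ^ suc (suc n))) ≡⟨ assoc ((w + v) ^ n) (w + v) _ ⟩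
    (w + v) ^ suc n * (w * x ^ suc (suc n) + v * y ^ suc (suc n)) ∎
    where
    open ℕ.≤-Reasoning
    N = w * x + v * y
    swap : ∀ a b c → a * (b * c) ≡ b * (a * c)
    swap = solve-∀
    assoc : ∀ a b c → a * (b * c) ≡ b * a * c
    assoc = solve-∀
    mono : x * y ^ suc n + y * x ^ suc n ≤ℕ x * x ^ suc n + y * y ^ suc n
    mono with ℕ.≤-total x y
    ... | inj₁ h = chebyshev-sum h (ℕ.^-monoˡ-≤ (suc n) h)
    ... | inj₂ h = subst₂ _≤ℕ_ (ℕ.+-comm (y * x ^ suc n) _) (ℕ.+-comm (y * y ^ suc n) _) (chebyshev-sum h (ℕ.^-monoˡ-≤ (suc n) h))
    expand : ∀ X Y → x * Y + y * X ≤ℕ x * X + y * Y → N * (w * X + v * Y) ≤ℕ (w + v) * (w * (x * X) + v * (y * Y))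
    expand X Y h = ≤-by (ℕ.*-monoʳ-≤ (w * v) h) (identity w v x y X Y)
      where
      identity : ∀ w v x y X Y → (w * x + v * y) * (w * X + v * Y) + w * v * (x * X + y * Y)
        ≡ (w + v) * (w * (x * X) + v * (y * Y)) + w * v * (x * Y + y * X)
      identity = solve-∀

  -- Bernoulli's inequality (1 + nu)(1 - u)^n ≤ 1 with u = v / (r + v), cleared of denominators.
  bernoulli : ∀ r v n → r ^ n * (r + v + n * v) ≤ℕ (r + v) ^ suc n
  bernoulli r v zero    = ℕ.≤-reflexive (base r v)
    where
    base : ∀ r v → 1 * (r + v + 0 * v) ≡ (r + v) * 1
    base = solve-∀
  bernoulli r v (suc n) = begin
    r * r ^ n * (r + v + (v + n * v))      ≡⟨ assoc r (r ^ n) _ ⟩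
    r ^ n * (r * (r + v + (v + n * v)))    ≤⟨ ℕ.*-monoʳ-≤ (r ^ n) (ℕ.≤-trans (ℕ.m≤m+n _ (v * v + n * v * v)) (ℕ.≤-reflexive (identity r v n))) ⟩
    r ^ n * ((r + v + n * v) * (r + v))    ≡⟨ ℕ.*-assoc (r ^ n) _ _ ⟨
    r ^ n * (r + v + n * v) * (r + v)      ≤⟨ ℕ.*-monoˡ-≤ (r + v) (bernoulli r v n) ⟩
    (r + v) ^ suc n * (r + v)              ≡⟨ ℕ.*-comm ((r + v) ^ suc n) (r + v) ⟩
    (r + v) ^ suc (suc n)                  ∎
    where
    open ℕ.≤-Reasoning
    assoc : ∀ a b c → a * b * c ≡ b * (a * c)
    assoc = solve-∀
    identity : ∀ r v n → r * (r + v + (v + n * v)) + (v * v + n * v * v) ≡ (r + v + n * v) * (r + v)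
    identity = solve-∀

  *-^ : ∀ x y n → (x * y) ^ n ≡ x ^ n * y ^ n
  *-^ x y zero    = refl
  *-^ x y (suc n) = trans (cong (x * y *_) (*-^ x y n)) (interchange x y (x ^ n) (y ^ n))
    where
    interchange : ∀ x y p q → x * y * (p * q) ≡ x * p * (y * q)
    interchange = solve-∀

  -- The estimate for one composition.

  -- The exponent of q in the potential is suc a.
  abstract
    a : ℕ
    a = 33

    16≤a : 16 ≤ℕ suc a
    16≤a = ℕ.≤ᵇ⇒≤ 16 34 tt

    -- This fixes the value 33, the least exponent at which the power of 16/15 reaches 8.
    8·15^a≤16^a : 8 * 15 ^ a ≤ℕ 16 ^ a
    8·15^a≤16^a = ℕ.≤ᵇ⇒≤ (8 * 15 ^ 33) (16 ^ 33) tt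

    16·4^a≤6^a : 16 * 4 ^ suc a ≤ℕ 6 ^ suc a
    16·4^a≤6^a = ℕ.≤ᵇ⇒≤ (16 * 4 ^ 34) (6 ^ 34) tt

  8≤2^a : 8 ≤ℕ 2 ^ suc a
  8≤2^a = ℕ.≤-trans (ℕ.≤ᵇ⇒≤ 8 (2 ^ 16) tt) (ℕ.^-monoʳ-≤ 2 16≤a)

  -- A segment leads to one target on `w` inputs and to the other on `v` inputs; `X` and `Y` are the
  -- acceptance counts from the targets, and `γw` and `γv` the counts of formulas for reaching them.
  -- So `N` is the acceptance count before the segment.
  module _ (w v γw γv X Y : ℕ) (hw : w ≤ℕ 2 * γw) (hv : v ≤ℕ 2 * γv) where
    private
      W = w + v
      N = w * X + v * Y
      factor : ∀ γ x δ y → 2 * γ * x + 2 * δ * y ≡ 2 * (γ * x + δ * y)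
      factor = solve-∀
      collect : ∀ k γ x → k * (2 * (γ * x + γ * x)) ≡ 4 * (γ * k * x)
      collect = solve-∀
    open ℕ.≤-Reasoning

    -- The constant 4 is 2 · 2: one factor for keeping only the larger summand, one for replacing a
    -- reaching probability by its formula.
    jensen-max : (N ^ suc a ≤ℕ 4 * (γw * W ^ a * X ^ suc a)) ⊎ (N ^ suc a ≤ℕ 4 * (γv * W ^ a * Y ^ suc a))
    jensen-max with ℕ.≤-total (γv * Y ^ suc a) (γw * X ^ suc a)
    ... | inj₁ h = inj₁ (begin
      N ^ suc a                                                    ≤⟨ jensen a w v X Y ⟩
      W ^ a * (w * X ^ suc a + v * Y ^ suc a)                      ≤⟨ ℕ.*-monoʳ-≤ (W ^ a) (ℕ.+-mono-≤ (ℕ.*-monoˡ-≤ (X ^ suc a) hw) (ℕ.*-monoˡ-≤ (Y ^ suc a) hv)) ⟩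
      W ^ a * (2 * γw * X ^ suc a + 2 * γv * Y ^ suc a)            ≡⟨ cong (W ^ a *_) (factor γw (X ^ suc a) γv (Y ^ suc a)) ⟩
      W ^ a * (2 * (γw * X ^ suc a + γv * Y ^ suc a))              ≤⟨ ℕ.*-monoʳ-≤ (W ^ a) (ℕ.*-monoʳ-≤ 2 (ℕ.+-monoʳ-≤ (γw * X ^ suc a) h)) ⟩
      W ^ a * (2 * (γw * X ^ suc a + γw * X ^ suc a))              ≡⟨ collect (W ^ a) γw (X ^ suc a) ⟩
      4 * (γw * W ^ a * X ^ suc a) ∎)
    ... | inj₂ h = inj₂ (begin
      N ^ suc a                                                    ≤⟨ jensen a w v X Y ⟩
      W ^ a * (w * X ^ suc a + v * Y ^ suc a)                      ≤⟨ ℕ.*-monoʳ-≤ (W ^ a) (ℕ.+-mono-≤ (ℕ.*-monoˡ-≤ (X ^ suc a) hw) (ℕ.*-monoˡ-≤ (Y ^ suc a) hv)) ⟩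
      W ^ a * (2 * γw * X ^ suc a + 2 * γv * Y ^ suc a)            ≡⟨ cong (W ^ a *_) (factor γw (X ^ suc a) γv (Y ^ suc a)) ⟩
      W ^ a * (2 * (γw * X ^ suc a + γv * Y ^ suc a))              ≤⟨ ℕ.*-monoʳ-≤ (W ^ a) (ℕ.*-monoʳ-≤ 2 (ℕ.+-monoˡ-≤ (γv * Y ^ suc a) h)) ⟩
      W ^ a * (2 * (γv * Y ^ suc a + γv * Y ^ suc a))              ≡⟨ collect (W ^ a) γv (Y ^ suc a) ⟩
      4 * (γv * W ^ a * Y ^ suc a) ∎)

    -- Case Y ≤ 3X/4 with w/W ≥ 3/4: missing the better target costs 1 - O(v/W), while N/(W X) ≤ 1 - v/(4W).
    likely : .{{_ : NonZero W}} → 2 * w ≤ℕ γw + W → 3 * v ≤ℕ w → 4 * Y ≤ℕ 3 * X → N ^ suc a ≤ℕ γw * W ^ a * X ^ suc a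
    likely hγ h k = ℕ.*-cancelˡ-≤ (4 ^ suc a) {{ℕ.m^n≢0 4 (suc a)}} (begin
      4 ^ suc a * N ^ suc a                       ≡⟨ *-^ 4 N (suc a) ⟨
      (4 * N) ^ suc a                             ≤⟨ ℕ.^-monoˡ-≤ (suc a) 4N≤ ⟩
      ((4 * w + 3 * v) * X) ^ suc a               ≡⟨ *-^ (4 * w + 3 * v) X (suc a) ⟩
      (4 * w + 3 * v) ^ suc a * X ^ suc a         ≤⟨ ℕ.*-monoˡ-≤ (X ^ suc a) power ⟩
      4 * γw * (4 * W) ^ a * X ^ suc a            ≡⟨ cong (λ z → 4 * γw * z * X ^ suc a) (*-^ 4 W a) ⟩
      4 * γw * (4 ^ a * W ^ a) * X ^ suc a        ≡⟨ regroup γw (4 ^ a) (W ^ a) (X ^ suc a) ⟩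
      4 ^ suc a * (γw * W ^ a * X ^ suc a)        ∎)
      where
      R = 4 * w + 3 * v
      T = R + v
      T≡4W : T ≡ 4 * W
      T≡4W = lemma w v
        where
        lemma : ∀ w v → 4 * w + 3 * v + v ≡ 4 * (w + v)
        lemma = solve-∀
      regroup : ∀ g p q x → 4 * g * (p * q) * x ≡ 4 * p * (g * q * x)
      regroup = solve-∀
      4N≤ : 4 * N ≤ℕ R * X
      4N≤ = ≤-by (ℕ.*-monoʳ-≤ v k) (lemma w v X Y)
        where
        lemma : ∀ w v X Y → 4 * (w * X + v * Y) + v * (3 * X) ≡ (4 * w + 3 * v) * X + v * (4 * Y)
        lemma = solve-∀
      -- Here γw ≥ w - v. Writing w = 3v + u, the factor 16 makes the terms in v² balance exactly
      -- and leaves 32uv to spare.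
      square : T * T ≤ℕ 4 * γw * (T + suc a * v)
      square with ℕ.m≤n⇒∃[o]m+o≡n h
      ... | u , refl = begin
        (4 * (3 * v + u) + 3 * v + v) * (4 * (3 * v + u) + 3 * v + v) ≤⟨ ℕ.m≤m+n _ (32 * (u * v)) ⟩
        (4 * (3 * v + u) + 3 * v + v) * (4 * (3 * v + u) + 3 * v + v) + 32 * (u * v) ≡⟨ lemma u v ⟩
        4 * (2 * v + u) * (4 * (3 * v + u) + 3 * v + v + 16 * v)      ≤⟨ ℕ.*-mono-≤ (ℕ.*-monoʳ-≤ 4 γ≥) (ℕ.+-monoʳ-≤ (4 * (3 * v + u) + 3 * v + v) (ℕ.*-monoˡ-≤ v 16≤a)) ⟩
        4 * γw * (4 * (3 * v + u) + 3 * v + v + suc a * v)            ∎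
        where
        lemma : ∀ u v → (4 * (3 * v + u) + 3 * v + v) * (4 * (3 * v + u) + 3 * v + v) + 32 * (u * v) ≡ 4 * (2 * v + u) * (4 * (3 * v + u) + 3 * v + v + 16 * v)
        lemma = solve-∀
        γ≥ : 2 * v + u ≤ℕ γw
        γ≥ = ≤-by hγ (identity u v γw)
          where
          identity : ∀ u v γ → 2 * v + u + (γ + (3 * v + u + v)) ≡ γ + 2 * (3 * v + u)
          identity = solve-∀
      -- By Bernoulli, (R / T)^(a+1) ≤ T / (T + (a+1)v), which `square` bounds by 4γw / T = γw / W.
      power : R ^ suc a ≤ℕ 4 * γw * (4 * W) ^ a
      power = ℕ.*-cancelʳ-≤ (R ^ suc a) (4 * γw * (4 * W) ^ a) (T + suc a * v) {{T≢0}} (begin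
        R ^ suc a * (T + suc a * v)             ≤⟨ bernoulli R v (suc a) ⟩
        T * (T * T ^ a)                         ≡⟨ ℕ.*-assoc T T (T ^ a) ⟨
        T * T * T ^ a                           ≤⟨ ℕ.*-monoˡ-≤ (T ^ a) square ⟩
        4 * γw * (T + suc a * v) * T ^ a        ≡⟨ swap (4 * γw) (T + suc a * v) (T ^ a) ⟩
        4 * γw * T ^ a * (T + suc a * v)        ≡⟨ cong (λ z → 4 * γw * z ^ a * (T + suc a * v)) T≡4W ⟩
        4 * γw * (4 * W) ^ a * (T + suc a * v)  ∎)
        where
        swap : ∀ x y z → x * y * z ≡ x * z * y
        swap = solve-∀
        T≢0 : NonZero (T + suc a * v)
        T≢0 = Nat.>-nonZero (ℕ.<-≤-trans (Nat.>-nonZero⁻¹ W) (ℕ.≤-trans (ℕ.≤-trans (ℕ.m≤m+n W _) (ℕ.≤-reflexive (sym T≡4W))) (ℕ.m≤m+n T _)))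

    -- Case Y ≤ 3X/4 with w/W ≤ 3/4: N ≤ 15WX/16, and its power absorbs a constant factor.
    unlikely : w ≤ℕ 3 * v → 4 * Y ≤ℕ 3 * X → N ≤ℕ 4 * (w * X) → N ^ suc a ≤ℕ γw * W ^ a * X ^ suc a
    unlikely h k l = ℕ.*-cancelˡ-≤ (16 ^ a) {{ℕ.m^n≢0 16 a}} (begin
      16 ^ a * (N * N ^ a)                        ≡⟨ swap (16 ^ a) N (N ^ a) ⟩
      N * (16 ^ a * N ^ a)                        ≡⟨ cong (N *_) (*-^ 16 N a) ⟨
      N * (16 * N) ^ a                            ≤⟨ ℕ.*-mono-≤ N≤ (ℕ.^-monoˡ-≤ a 16N≤) ⟩
      8 * (γw * X) * (15 * (W * X)) ^ a           ≡⟨ cong (8 * (γw * X) *_) (trans (*-^ 15 (W * X) a) (cong (15 ^ a *_) (*-^ W X a))) ⟩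
      8 * (γw * X) * (15 ^ a * (W ^ a * X ^ a))   ≡⟨ regroup γw X (15 ^ a) (W ^ a) (X ^ a) ⟩
      8 * 15 ^ a * (γw * W ^ a * X ^ suc a)       ≤⟨ ℕ.*-monoˡ-≤ (γw * W ^ a * X ^ suc a) 8·15^a≤16^a ⟩
      16 ^ a * (γw * W ^ a * X ^ suc a)           ∎)
      where
      swap : ∀ x y z → x * (y * z) ≡ y * (x * z)
      swap = solve-∀
      regroup : ∀ g x p q r → 8 * (g * x) * (p * (q * r)) ≡ 8 * p * (g * q * (x * r))
      regroup = solve-∀
      -- One factor `N` is set aside to bring in `γw`; the remaining `a` factors pay for the 8.
      N≤ : N ≤ℕ 8 * (γw * X)
      N≤ = ℕ.≤-trans l (ℕ.≤-trans (ℕ.*-monoʳ-≤ 4 (ℕ.*-monoˡ-≤ X hw)) (ℕ.≤-reflexive (lemma γw X)))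
        where
        lemma : ∀ g x → 4 * (2 * g * x) ≡ 8 * (g * x)
        lemma = solve-∀
      16N≤ : 16 * N ≤ℕ 15 * (W * X)
      16N≤ = ≤-by (ℕ.+-mono-≤ (ℕ.*-monoʳ-≤ (4 * v) k) (ℕ.*-monoˡ-≤ X h)) (lemma w v X Y)
        where
        lemma : ∀ w v X Y → 16 * (w * X + v * Y) + (4 * v * (3 * X) + 3 * v * X) ≡ 15 * ((w + v) * X) + (4 * v * (4 * Y) + w * X)
        lemma = solve-∀

    -- The worse target contributes at least three quarters of `N`. The surplus `2 ^ suc a` of a
    -- dying state outweighs the power of 4/3, the factor 2 in `hv` and the 8 on the left.
    fallback : 4 * (w * X) ≤ℕ N → 8 * N ^ suc a ≤ℕ γv * W ^ a * (2 ^ suc a * Y ^ suc a)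
    fallback l = ℕ.*-cancelˡ-≤ (3 ^ suc a) {{ℕ.m^n≢0 3 (suc a)}} (begin
      3 ^ suc a * (8 * N ^ suc a)                         ≡⟨ swap (3 ^ suc a) 8 (N ^ suc a) ⟩
      8 * (3 ^ suc a * N ^ suc a)                         ≡⟨ cong (8 *_) (*-^ 3 N (suc a)) ⟨
      8 * (3 * N) ^ suc a                                 ≤⟨ ℕ.*-monoʳ-≤ 8 (ℕ.^-monoˡ-≤ (suc a) 3N≤) ⟩
      8 * (4 * (v * Y)) ^ suc a                           ≡⟨ cong (8 *_) (trans (*-^ 4 (v * Y) (suc a)) (cong (4 ^ suc a *_) (*-^ v Y (suc a)))) ⟩
      8 * (4 ^ suc a * (v * v ^ a * Y ^ suc a))           ≤⟨ ℕ.*-monoʳ-≤ 8 (ℕ.*-monoʳ-≤ (4 ^ suc a) (ℕ.*-monoˡ-≤ (Y ^ suc a) (ℕ.*-mono-≤ hv (ℕ.^-monoˡ-≤ a (ℕ.m≤n+m v w))))) ⟩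
      8 * (4 ^ suc a * (2 * γv * W ^ a * Y ^ suc a))      ≡⟨ regroup (4 ^ suc a) γv (W ^ a) (Y ^ suc a) ⟩
      16 * 4 ^ suc a * (γv * W ^ a * Y ^ suc a)           ≤⟨ ℕ.*-monoˡ-≤ (γv * W ^ a * Y ^ suc a) 16·4^a≤6^a ⟩
      6 ^ suc a * (γv * W ^ a * Y ^ suc a)                ≡⟨ cong (_* (γv * W ^ a * Y ^ suc a)) (*-^ 3 2 (suc a)) ⟩
      3 ^ suc a * 2 ^ suc a * (γv * W ^ a * Y ^ suc a)    ≡⟨ move (3 ^ suc a) (2 ^ suc a) (γv * W ^ a) (Y ^ suc a) ⟩
      3 ^ suc a * (γv * W ^ a * (2 ^ suc a * Y ^ suc a))  ∎)
      where
      swap : ∀ x y z → x * (y * z) ≡ y * (x * z)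
      swap = solve-∀
      regroup : ∀ p g q y → 8 * (p * (2 * g * q * y)) ≡ 16 * p * (g * q * y)
      regroup = solve-∀
      move : ∀ p q r y → p * q * (r * y) ≡ p * (r * (q * y))
      move = solve-∀
      3N≤ : 3 * N ≤ℕ 4 * (v * Y)
      3N≤ = ≤-by l (lemma w v X Y)
        where
        lemma : ∀ w v X Y → 3 * (w * X + v * Y) + (w * X + v * Y) ≡ 4 * (v * Y) + 4 * (w * X)
        lemma = solve-∀

    module _ (Γp Γr Z K : ℕ) (hp : X ^ suc a * Z ^ 4 ≤ℕ Γp * K) (hr : Y ^ suc a * Z ^ 4 ≤ℕ Γr * K) (X≤Z : X ≤ℕ Z) where

      private
        chain : ∀ c γ U Γ → N ^ suc a * c ≤ℕ γ * W ^ a * U * Z ^ 4 → U * Z ^ 4 ≤ℕ Γ * K → N ^ suc a * c ≤ℕ γ * Γ * K * W ^ a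
        chain c γ U Γ h k = begin
          N ^ suc a * c              ≤⟨ h ⟩
          γ * W ^ a * U * Z ^ 4      ≡⟨ ℕ.*-assoc (γ * W ^ a) U (Z ^ 4) ⟩
          γ * W ^ a * (U * Z ^ 4)    ≤⟨ ℕ.*-monoʳ-≤ (γ * W ^ a) k ⟩
          γ * W ^ a * (Γ * K)        ≡⟨ lemma γ (W ^ a) Γ K ⟩
          γ * Γ * K * W ^ a          ∎
          where
          lemma : ∀ g q Γ K → g * q * (Γ * K) ≡ g * Γ * K * q
          lemma = solve-∀

        gap : ∀ γ U → N ^ suc a ≤ℕ 4 * (γ * W ^ a * U) → 4 * X ^ 4 ≤ℕ Z ^ 4 → N ^ suc a * X ^ 4 ≤ℕ γ * W ^ a * U * Z ^ 4
        gap γ U h k = begin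
          N ^ suc a * X ^ 4              ≤⟨ ℕ.*-monoˡ-≤ (X ^ 4) h ⟩
          4 * (γ * W ^ a * U) * X ^ 4    ≡⟨ lemma (γ * W ^ a * U) (X ^ 4) ⟩
          γ * W ^ a * U * (4 * X ^ 4)    ≤⟨ ℕ.*-monoʳ-≤ (γ * W ^ a * U) k ⟩
          γ * W ^ a * U * Z ^ 4          ∎
          where
          lemma : ∀ u x → 4 * u * x ≡ u * (4 * x)
          lemma = solve-∀

        X⁴≤Z⁴ : X ^ 4 ≤ℕ Z ^ 4
        X⁴≤Z⁴ = ℕ.^-monoˡ-≤ 4 X≤Z

        -- This is why `Z` has exponent 4: (3/2)^4 = 81/16 exceeds 4, while (3/2)^3 does not.
        4X⁴≤Z⁴ : 3 * X ≤ℕ 2 * Z → 4 * X ^ 4 ≤ℕ Z ^ 4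
        4X⁴≤Z⁴ h = ℕ.*-cancelˡ-≤ 16 (ℕ.≤-trans (ℕ.≤-reflexive (sym (ℕ.*-assoc 16 4 (X ^ 4))))
          (ℕ.≤-trans (ℕ.*-monoˡ-≤ (X ^ 4) (ℕ.≤ᵇ⇒≤ 64 81 tt))
          (subst₂ _≤ℕ_ (*-^ 3 X 4) (*-^ 2 Z 4) (ℕ.^-monoˡ-≤ 4 h))))

        -- Lowering the reference from `Z` to `X` gains the factor 4 lost by `jensen-max`.
        advance-gap : 3 * X ≤ℕ 2 * Z →
          (N ^ suc a * X ^ 4 ≤ℕ γw * Γp * K * W ^ a) ⊎ (N ^ suc a * X ^ 4 ≤ℕ γv * Γr * K * W ^ a)
        advance-gap h with jensen-max
        ... | inj₁ j = inj₁ (chain (X ^ 4) γw (X ^ suc a) Γp (gap γw (X ^ suc a) j (4X⁴≤Z⁴ h)) hp)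
        ... | inj₂ j = inj₂ (chain (X ^ 4) γv (Y ^ suc a) Γr (gap γv (Y ^ suc a) j (4X⁴≤Z⁴ h)) hr)

        scale : ∀ γ U Γ → N ^ suc a ≤ℕ 4 * (γ * W ^ a * U) → U * Z ^ 4 ≤ℕ Γ * K → N ^ suc a * X ^ 4 ≤ℕ 4 * (γ * Γ * K * W ^ a)
        scale γ U Γ h k = begin
          N ^ suc a * X ^ 4                ≤⟨ ℕ.*-mono-≤ h X⁴≤Z⁴ ⟩
          4 * (γ * W ^ a * U) * Z ^ 4      ≡⟨ lemma (γ * W ^ a) U (Z ^ 4) ⟩
          4 * (γ * W ^ a) * (U * Z ^ 4)    ≤⟨ ℕ.*-monoʳ-≤ (4 * (γ * W ^ a)) k ⟩
          4 * (γ * W ^ a) * (Γ * K)        ≡⟨ lemma′ γ (W ^ a) Γ K ⟩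
          4 * (γ * Γ * K * W ^ a)          ∎
          where
          lemma : ∀ g u z → 4 * (g * u) * z ≡ 4 * g * (u * z)
          lemma = solve-∀
          lemma′ : ∀ g q Γ K → 4 * (g * q) * (Γ * K) ≡ 4 * (g * Γ * K * q)
          lemma′ = solve-∀

      advance-after-death :
        (N ^ suc a * X ^ 4 ≤ℕ 4 * (γw * Γp * K * W ^ a)) ⊎ (N ^ suc a * X ^ 4 ≤ℕ 4 * (γv * Γr * K * W ^ a))
      advance-after-death with jensen-max
      ... | inj₁ j = inj₁ (scale γw (X ^ suc a) Γp j hp)
      ... | inj₂ j = inj₂ (scale γv (Y ^ suc a) Γr j hr)

      -- If the better target is the dying state, then X ≤ Z / 2 and there is a gap. Otherwise the
      -- worse one is, with Y ≤ Z / 2: either Y ≥ 3X / 4 forces X ≤ 2Z / 3, again a gap, or the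
      -- choice of target depends on `w` and on its share of `N`.
      advance : .{{_ : NonZero W}} → 2 * w ≤ℕ γw + W →
        (2 * X ≤ℕ Z) ⊎ (2 * Y ≤ℕ Z × 2 ^ suc a * Y ^ suc a * Z ^ 4 ≤ℕ 8 * (Γr * K)) →
        (N ^ suc a * X ^ 4 ≤ℕ γw * Γp * K * W ^ a) ⊎ (N ^ suc a * X ^ 4 ≤ℕ γv * Γr * K * W ^ a)
      advance hγ (inj₁ 2X≤Z) = advance-gap (ℕ.≤-trans (ℕ.≤-trans (ℕ.*-monoˡ-≤ X (ℕ.≤ᵇ⇒≤ 3 4 tt)) (ℕ.≤-reflexive (ℕ.*-assoc 2 2 X))) (ℕ.*-monoʳ-≤ 2 2X≤Z))
      advance hγ (inj₂ (2Y≤Z , hr′)) with ℕ.≤-total (3 * X) (4 * Y)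
      ... | inj₁ h = advance-gap (ℕ.≤-trans h (ℕ.≤-trans (ℕ.≤-reflexive (ℕ.*-assoc 2 2 Y)) (ℕ.*-monoʳ-≤ 2 2Y≤Z)))
      ... | inj₂ h with ℕ.≤-total (3 * v) w
      ...   | inj₁ k = inj₁ (chain (X ^ 4) γw (X ^ suc a) Γp (ℕ.*-mono-≤ (likely hγ k h) X⁴≤Z⁴) hp)
      ...   | inj₂ k with ℕ.≤-total N (4 * (w * X))
      ...     | inj₁ l = inj₁ (chain (X ^ 4) γw (X ^ suc a) Γp (ℕ.*-mono-≤ (unlikely k h l) X⁴≤Z⁴) hp)
      ...     | inj₂ l = inj₂ (ℕ.*-cancelˡ-≤ 8 (begin
          8 * (N ^ suc a * X ^ 4)                           ≡⟨ ℕ.*-assoc 8 (N ^ suc a) (X ^ 4) ⟨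
          8 * N ^ suc a * X ^ 4                             ≤⟨ ℕ.*-mono-≤ (fallback l) X⁴≤Z⁴ ⟩
          γv * W ^ a * (2 ^ suc a * Y ^ suc a) * Z ^ 4      ≡⟨ ℕ.*-assoc (γv * W ^ a) (2 ^ suc a * Y ^ suc a) (Z ^ 4) ⟩
          γv * W ^ a * (2 ^ suc a * Y ^ suc a * Z ^ 4)      ≤⟨ ℕ.*-monoʳ-≤ (γv * W ^ a) hr′ ⟩
          γv * W ^ a * (8 * (Γr * K))                       ≡⟨ lemma γv (W ^ a) Γr K ⟩
          8 * (γv * Γr * K * W ^ a)                         ∎))
        where
        lemma : ∀ g q Γ K → g * q * (8 * (Γ * K)) ≡ 8 * (g * Γ * K * q)
        lemma = solve-∀

  -- Programs with two live states and their checkpoints.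

  Layer : Set
  Layer = Bool → Bool → Maybe Bool

  accepts : ∀ {m} → Vec Layer m → Bool → Vec Bool m → Bool
  accepts []      s []      = s
  accepts (l ∷ L) s (b ∷ x) = maybe′ (λ s′ → accepts L s′ x) false (l b s)

  -- `bound` says q^(a+1) z^4 ≤ Γ / 2^m, where q and z are the counts `# f` and `Z` divided by 2^m.
  record Bounded (Z : ℕ) {m} (f : Vec Bool m → Bool) : Set where
    field
      {Γ}      : ℕ
      achieved : Ach f Γ
      bound    : # f ^ suc a * Z ^ 4 ≤ℕ Γ * (2 ^ m) ^ (a + 4)
      below    : # f ≤ℕ Z

  -- The invariant of a state with a dying edge, stronger than `Bounded` by the factor 2^(a+1) / 8.
  record Dangerous (Z : ℕ) {m} (f : Vec Bool m → Bool) : Set where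
    field
      bounded : Bounded Z f
    open Bounded bounded public
    field
      twice  : 2 * # f ≤ℕ Z
      strong : 2 ^ suc a * # f ^ suc a * Z ^ 4 ≤ℕ 8 * (Γ * (2 ^ m) ^ (a + 4))

  -- Z is the larger of the two acceptance counts at the next checkpoint, rescaled to the present length.
  record Checkpoint {m} (F : Bool → Vec Bool m → Bool) : Set where
    field
      Z      : ℕ
      d      : Bool
      danger : Dangerous Z (F d)
      other  : Bounded Z (F (not d))

  module Crossing {ℓ m} (t : Seg ℓ) {F′ : Bool → Vec Bool m → Bool} (C : Checkpoint F′) where
    open Checkpoint C
    module D = Dangerous danger
    module O = Bounded other

    X : Bool → ℕ
    X τ = # (F′ τ)

    -- The next reference value; it becomes the new `Z` after rescaling to the longer input.
    H : ℕ
    H = X d ⊔ X (not d)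

    K : ℕ
    K = (2 ^ m) ^ (a + 4)

    -- Of the factors 2^ℓ, `a` match `W ^ a` in the one-step estimate and four rescale `H ^ 4`.
    scale : (2 ^ (ℓ + m)) ^ (a + 4) ≡ (2 ^ ℓ) ^ a * (2 ^ ℓ) ^ 4 * K
    scale = trans (cong (_^ (a + 4)) (ℕ.^-distribˡ-+-* 2 ℓ m))
      (trans (*-^ (2 ^ ℓ) (2 ^ m) (a + 4)) (cong (_* K) (ℕ.^-distribˡ-+-* (2 ^ ℓ) a 4)))

    module _ (s : Bool) {f : Vec Bool (ℓ + m) → Bool} (e : ∀ x y → f (x ++ y) ≡ F′ (evalSeg t x s) y) where

      hits : Bool → Vec Bool ℓ → Bool
      hits τ x = evalSeg t x s xor not τ

      w : Bool → ℕ
      w τ = # (hits τ)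

      hits-sound : ∀ τ x → hits τ x ≡ true → evalSeg t x s ≡ τ
      hits-sound τ x = lemma τ (evalSeg t x s)
        where
        lemma : ∀ τ σ → σ xor not τ ≡ true → σ ≡ τ
        lemma true  true  _ = refl
        lemma false false _ = refl

      w-sum : w d + w (not d) ≡ 2 ^ ℓ
      w-sum = trans (cong (w d +_) (#-cong (λ x → lemma d (evalSeg t x s)))) (#-not (hits d))
        where
        lemma : ∀ τ σ → σ xor not (not τ) ≡ not (σ xor not τ)
        lemma true  true  = refl
        lemma true  false = refl
        lemma false true  = refl
        lemma false false = refl

      -- Total probability over the state reached at the checkpoint.
      #f : # f ≡ w d * X d + w (not d) * X (not d)
      #f = trans (∑-++ ℓ m (bit ∘ f)) (trans (∑-cong ℓ (λ x → trans (#-cong (e x)) (branch d (evalSeg t x s))))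
        (trans (∑-+ ℓ _ _) (cong₂ _+_ (∑-* ℓ (X d) _) (∑-* ℓ (X (not d)) _))))
        where
        branch : ∀ d σ → X σ ≡ bit (σ xor not d) * X d + bit (σ xor not (not d)) * X (not d)
        branch true  true  = sym (trans (ℕ.+-identityʳ _) (ℕ.+-identityʳ (X true)))
        branch true  false = sym (ℕ.+-identityʳ (X false))
        branch false true  = sym (ℕ.+-identityʳ (X true))
        branch false false = sym (trans (ℕ.+-identityʳ _) (ℕ.+-identityʳ (X false)))

      γ : Bool → ℕ
      γ τ = proj₁ (ach-seg t s (not τ))

      w≤2γ : ∀ τ → w τ ≤ℕ 2 * γ τ
      w≤2γ τ = proj₁ (proj₂ (proj₂ (ach-seg t s (not τ))))

      2w≤γ+ : ∀ τ → 2 * w τ ≤ℕ γ τ + 2 ^ ℓ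
      2w≤γ+ τ = proj₂ (proj₂ (proj₂ (ach-seg t s (not τ))))

      via : ∀ τ {Γ} → Ach (F′ τ) Γ → Ach f (γ τ * Γ)
      via τ = ach-⊗ (λ x y h k → trans (e x y) (trans (cong (λ σ → F′ σ y) (hits-sound τ x h)) k)) (proj₁ (proj₂ (ach-seg t s (not τ))))

      #f≤ : # f ≤ℕ 2 ^ ℓ * H
      #f≤ = begin
        # f                                  ≡⟨ #f ⟩
        w d * X d + w (not d) * X (not d)    ≤⟨ ℕ.+-mono-≤ (ℕ.*-monoʳ-≤ (w d) (ℕ.m≤m⊔n _ _)) (ℕ.*-monoʳ-≤ (w (not d)) (ℕ.m≤n⊔m _ _)) ⟩
        w d * H + w (not d) * H              ≡⟨ ℕ.*-distribʳ-+ H (w d) _ ⟨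
        (w d + w (not d)) * H                ≡⟨ cong (_* H) w-sum ⟩
        2 ^ ℓ * H                            ∎
        where open ℕ.≤-Reasoning

      #f′ : # f ≡ w (not d) * X (not d) + w d * X d
      #f′ = trans #f (ℕ.+-comm (w d * X d) _)

      w-sum′ : w (not d) + w d ≡ 2 ^ ℓ
      w-sum′ = trans (ℕ.+-comm (w (not d)) _) w-sum

      W≢0 : ∀ {W} → W ≡ 2 ^ ℓ → NonZero W
      W≢0 refl = ℕ.m^n≢0 2 ℓ

      choose : ∀ {P : ℕ → Set} {Γ Γ′} τ τ′ → Ach (F′ τ) Γ → Ach (F′ τ′) Γ′ →
        P (γ τ * Γ) ⊎ P (γ τ′ * Γ′) → ∃ λ Γ → Ach f Γ × P Γ
      choose τ τ′ A A′ (inj₁ p) = _ , via τ A , p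
      choose τ τ′ A A′ (inj₂ p) = _ , via τ′ A′ , p

      -- The better target is put first. If it is `d`, then `twice` supplies the gap; if not,
      -- `strong` covers the other target.
      forward : ∃ λ Γ → Ach f Γ × # f ^ suc a * H ^ 4 ≤ℕ Γ * K * (2 ^ ℓ) ^ a
      forward with ℕ.≤-total (X (not d)) (X d)
      ... | inj₁ h rewrite ℕ.m≥n⇒m⊔n≡m h | #f | sym w-sum = choose d (not d) D.achieved O.achieved
          (advance (w d) (w (not d)) (γ d) (γ (not d)) (X d) (X (not d)) (w≤2γ d) (w≤2γ (not d)) D.Γ O.Γ Z K
            D.bound O.bound D.below {{W≢0 w-sum}} (subst (λ z → 2 * w d ≤ℕ γ d + z) (sym w-sum) (2w≤γ+ d)) (inj₁ D.twice))
      ... | inj₂ h rewrite ℕ.m≤n⇒m⊔n≡n h | #f′ | sym w-sum′ = choose (not d) d O.achieved D.achieved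
          (advance (w (not d)) (w d) (γ (not d)) (γ d) (X (not d)) (X d) (w≤2γ (not d)) (w≤2γ d) O.Γ D.Γ Z K
            O.bound D.bound O.below {{W≢0 w-sum′}} (subst (λ z → 2 * w (not d) ≤ℕ γ (not d) + z) (sym w-sum′) (2w≤γ+ (not d)))
            (inj₂ (D.twice , D.strong)))

      forward-after-death : ∃ λ Γ → Ach f Γ × # f ^ suc a * H ^ 4 ≤ℕ 4 * (Γ * K * (2 ^ ℓ) ^ a)
      forward-after-death with ℕ.≤-total (X (not d)) (X d)
      ... | inj₁ h rewrite ℕ.m≥n⇒m⊔n≡m h | #f | sym w-sum = choose d (not d) D.achieved O.achieved
          (advance-after-death (w d) (w (not d)) (γ d) (γ (not d)) (X d) (X (not d)) (w≤2γ d) (w≤2γ (not d)) D.Γ O.Γ Z K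
            D.bound O.bound D.below)
      ... | inj₂ h rewrite ℕ.m≤n⇒m⊔n≡n h | #f′ | sym w-sum′ = choose (not d) d O.achieved D.achieved
          (advance-after-death (w (not d)) (w d) (γ (not d)) (γ d) (X (not d)) (X d) (w≤2γ (not d)) (w≤2γ d) O.Γ D.Γ Z K
            O.bound D.bound O.below)

      crossing : Bounded (2 ^ ℓ * H) f
      crossing with forward
      ... | Γ , A , h = record { achieved = A ; below = #f≤ ; bound = begin
          # f ^ suc a * (2 ^ ℓ * H) ^ 4                   ≡⟨ cong (# f ^ suc a *_) (*-^ (2 ^ ℓ) H 4) ⟩
          # f ^ suc a * ((2 ^ ℓ) ^ 4 * H ^ 4)             ≡⟨ swap (# f ^ suc a) ((2 ^ ℓ) ^ 4) (H ^ 4) ⟩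
          (2 ^ ℓ) ^ 4 * (# f ^ suc a * H ^ 4)             ≤⟨ ℕ.*-monoʳ-≤ ((2 ^ ℓ) ^ 4) h ⟩
          (2 ^ ℓ) ^ 4 * (Γ * K * (2 ^ ℓ) ^ a)             ≡⟨ regroup ((2 ^ ℓ) ^ 4) Γ K ((2 ^ ℓ) ^ a) ⟩
          Γ * ((2 ^ ℓ) ^ a * (2 ^ ℓ) ^ 4 * K)             ≡⟨ cong (Γ *_) scale ⟨
          Γ * (2 ^ (ℓ + m)) ^ (a + 4)                     ∎ }
        where
        open ℕ.≤-Reasoning
        swap : ∀ x y z → x * (y * z) ≡ y * (x * z)
        swap = solve-∀
        regroup : ∀ p g k q → p * (g * k * q) ≡ g * (q * p * k)
        regroup = solve-∀

    -- The count is unchanged while the cube doubles, so q halves and its power gains 2^(a+1). The 8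
    -- is 4 from the choice of target times 2 for the literal that avoids the dead edge.
    dying : ∀ {g : Vec Bool (suc ℓ + m) → Bool} {f} b → (∀ x → g (b ∷ x) ≡ false) → (∀ x → g (not b ∷ x) ≡ f x) →
      (∃ λ Γ → Ach f Γ × # f ^ suc a * H ^ 4 ≤ℕ 4 * (Γ * K * (2 ^ ℓ) ^ a)) → # f ≤ℕ 2 ^ ℓ * H → Dangerous (2 ^ suc ℓ * H) g
    dying {g} {f} b dead alive (Γ , A , h) f≤ = record
      { bounded = record { achieved = A′ ; bound = weak ; below = ℕ.≤-trans (ℕ.m≤m+n (# g) _) twice′ }
      ; twice = twice′ ; strong = strong′ }
      where
      open ℕ.≤-Reasoning
      #g : # g ≡ # f
      #g = trans (#-cons b g) (cong₂ _+_ (trans (#-cong dead) (#-false (ℓ + m))) (#-cong alive))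
      A′ : Ach g (1 * Γ)
      A′ = ach-⊗ (λ { (c ∷ []) x h k → trans (cong (λ c → g (c ∷ x)) (is-sound (not b) c h)) (trans (alive x) k) }) (ach-bit (not b)) A
      twice′ : 2 * # g ≤ℕ 2 ^ suc ℓ * H
      twice′ = subst₂ _≤ℕ_ (cong (2 *_) (sym #g)) (sym (ℕ.*-assoc 2 (2 ^ ℓ) H)) (ℕ.*-monoʳ-≤ 2 f≤)
      strong′ : 2 ^ suc a * # g ^ suc a * (2 ^ suc ℓ * H) ^ 4 ≤ℕ 8 * (1 * Γ * (2 ^ (suc ℓ + m)) ^ (a + 4))
      strong′ = begin
        2 ^ suc a * # g ^ suc a * (2 ^ suc ℓ * H) ^ 4
          ≡⟨ cong₂ (λ n z → 2 ^ suc a * n ^ suc a * z) #g (trans (*-^ (2 ^ suc ℓ) H 4) (cong (_* H ^ 4) (*-^ 2 (2 ^ ℓ) 4))) ⟩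
        2 * 2 ^ a * # f ^ suc a * (2 ^ 4 * (2 ^ ℓ) ^ 4 * H ^ 4)
          ≡⟨ lhs (2 ^ a) (# f ^ suc a) (2 ^ 4) ((2 ^ ℓ) ^ 4) (H ^ 4) ⟩
        2 * (2 ^ a * 2 ^ 4) * (2 ^ ℓ) ^ 4 * (# f ^ suc a * H ^ 4)
          ≤⟨ ℕ.*-monoʳ-≤ (2 * (2 ^ a * 2 ^ 4) * (2 ^ ℓ) ^ 4) h ⟩
        2 * (2 ^ a * 2 ^ 4) * (2 ^ ℓ) ^ 4 * (4 * (Γ * K * (2 ^ ℓ) ^ a))
          ≡⟨ rhs (2 ^ a * 2 ^ 4) ((2 ^ ℓ) ^ 4) Γ K ((2 ^ ℓ) ^ a) ⟩
        8 * (1 * Γ * (2 ^ a * 2 ^ 4 * ((2 ^ ℓ) ^ a * (2 ^ ℓ) ^ 4 * K)))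
          ≡⟨ cong (λ z → 8 * (1 * Γ * z)) (trans (cong₂ _*_ (sym (ℕ.^-distribˡ-+-* 2 a 4)) (sym scale)) (sym (*-^ 2 (2 ^ (ℓ + m)) (a + 4)))) ⟩
        8 * (1 * Γ * (2 ^ (suc ℓ + m)) ^ (a + 4)) ∎
        where
        lhs : ∀ p n q l h → 2 * p * n * (q * l * h) ≡ 2 * (p * q) * l * (n * h)
        lhs = solve-∀
        rhs : ∀ p l g k q → 2 * p * l * (4 * (g * k * q)) ≡ 8 * (1 * g * (p * (q * l * k)))
        rhs = solve-∀
      weak : # g ^ suc a * (2 ^ suc ℓ * H) ^ 4 ≤ℕ 1 * Γ * (2 ^ (suc ℓ + m)) ^ (a + 4)
      weak = ℕ.*-cancelˡ-≤ 8 (ℕ.≤-trans (ℕ.≤-reflexive (sym (ℕ.*-assoc 8 (# g ^ suc a) _)))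
        (ℕ.≤-trans (ℕ.*-monoˡ-≤ ((2 ^ suc ℓ * H) ^ 4) (ℕ.*-monoˡ-≤ (# g ^ suc a) 8≤2^a)) strong′))

  -- Backward induction over the layers.

  -- The induction hypothesis: a segment without dying edges leads to the next checkpoint.
  data Stretch : ∀ {m} → (Bool → Vec Bool m → Bool) → Set where
    stretch : ∀ {ℓ m} (t : Seg ℓ) {F′ : Bool → Vec Bool m → Bool} {F : Bool → Vec Bool (ℓ + m) → Bool} →
      Checkpoint F′ → (∀ s x y → F s (x ++ y) ≡ F′ (evalSeg t x s) y) → Stretch F

  data Fate (l : Layer) (s : Bool) : Set where
    dies  : ∀ b → l b s ≡ nothing → Fate l s
    lives : (∀ b → l b s ≡ just (fromMaybe true (l b s))) → Fate l s

  fate : ∀ l s → Fate l s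
  fate l s with l false s in p | l true s in q
  ... | nothing | _       = dies false p
  ... | just _  | nothing = dies true q
  ... | just _  | just _  = lives λ where
    false → trans p (cong (just ∘ fromMaybe true) (sym p))
    true  → trans q (cong (just ∘ fromMaybe true) (sym q))

  -- The default state is never taken: the segment is only started in a state both of whose edges
  -- survive.
  complete : Layer → Bool → Bool → Bool
  complete l b s = fromMaybe true (l b s)

  module _ {ℓ m} (t : Seg ℓ) {F′ : Bool → Vec Bool m → Bool} (C : Checkpoint F′)
    {F : Bool → Vec Bool (ℓ + m) → Bool} (e : ∀ s x y → F s (x ++ y) ≡ F′ (evalSeg t x s) y)
    (l : Layer) {G : Bool → Vec Bool (suc ℓ + m) → Bool} (step-eq : ∀ s b x → G s (b ∷ x) ≡ maybe′ (λ s′ → F s′ x) false (l b s)) where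
    open Crossing t C using (H; #f≤; forward-after-death; dying)

    lives-eval : ∀ s → (∀ b → l b s ≡ just (complete l b s)) → ∀ x y → G s (x ++ y) ≡ F′ (evalSeg (cons (complete l) t) x s) y
    lives-eval s h (b ∷ x) y rewrite step-eq s b (x ++ y) | h b | evalSeg-cons (complete l) t b x s = e (complete l b s) x y

    dies-bound : ∀ s b → l b s ≡ nothing → Dangerous (2 ^ suc ℓ * H) (G s)
    dies-bound s b h with l (not b) s in k
    ... | just s′ = dying b (λ x → trans (step-eq s b x) (cong (maybe′ _ false) h))
        (λ x → trans (step-eq s (not b) x) (cong (maybe′ _ false) k)) (forward-after-death s′ (e s′)) (#f≤ s′ (e s′))
    ... | nothing = dying b (λ x → trans (step-eq s b x) (cong (maybe′ _ false) h))
        (λ x → trans (step-eq s (not b) x) (cong (maybe′ _ false) k))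
        (0 , ach-zero , subst (λ z → z ^ suc a * H ^ 4 ≤ℕ 0) (sym (#-false (ℓ + m))) z≤n) (subst (_≤ℕ 2 ^ ℓ * H) (sym (#-false (ℓ + m))) z≤n)

    -- At a new checkpoint the other state may survive; it then crosses to the old checkpoint
    -- through the segment lengthened by this layer.
    any-bound : ∀ s → Bounded (2 ^ suc ℓ * H) (G s)
    any-bound s with fate l s
    ... | dies b h = Dangerous.bounded (dies-bound s b h)
    ... | lives h  = Crossing.crossing (cons (complete l) t) C s (lives-eval s h)

    checkpoint : ∀ s b → l b s ≡ nothing → Stretch G
    checkpoint s b h = stretch [] (record { Z = 2 ^ suc ℓ * H ; d = s ; danger = dies-bound s b h ; other = any-bound (not s) }) (λ { _ [] _ → refl })

    extend : Stretch G
    extend with fate l false | fate l true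
    ... | dies b h | _        = checkpoint false b h
    ... | lives _  | dies b h = checkpoint true b h
    ... | lives h  | lives k  = stretch (cons (complete l) t) C (λ { false → lives-eval false h ; true → lives-eval true k })

  accepts-stretch : ∀ {m} (L : Vec Layer m) → Stretch (accepts L)
  accepts-stretch [] = stretch [] end (λ { _ [] _ → refl })
    where
    -- The final layer serves as the first checkpoint, its rejecting state being the dangerous one.
    end : Checkpoint (accepts [])
    end = record
      { Z = 1
      ; d = false
      ; danger = record
        { bounded = record { achieved = ach-zero ; bound = z≤n ; below = z≤n }
        ; twice = z≤n
        ; strong = ℕ.≤-trans (ℕ.≤-reflexive (cong (_* 1) (ℕ.*-zeroʳ (2 ^ suc a)))) z≤n
        }
      ; other = record
        { achieved = ach-true (λ { [] → refl })
        ; bound = ℕ.≤-reflexive (trans (cong (_* 1) (ℕ.^-zeroˡ (suc a))) (sym (cong (1 *_) (ℕ.^-zeroˡ (a + 4)))))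
        ; below = ℕ.≤-refl
        }
      }
  accepts-stretch (l ∷ L) = go (accepts-stretch L) (λ _ _ _ → refl)
    where
    go : ∀ {m} {F : Bool → Vec Bool m → Bool} {G : Bool → Vec Bool (suc m) → Bool} → Stretch F →
      (∀ s b x → G s (b ∷ x) ≡ maybe′ (λ s′ → F s′ x) false (l b s)) → Stretch G
    go (stretch t C e) step-eq = extend t C e l step-eq

  -- Since q ≤ Z, the factor Z^4 may be weakened to q^4, giving total exponent a + 5.
  sudden-death : ∀ {m} (L : Vec Layer m) s → ∃ λ Γ → Ach (accepts L s) Γ × # (accepts L s) ^ suc (a + 4) ≤ℕ Γ * (2 ^ m) ^ (a + 4)
  sudden-death L s with accepts-stretch L
  ... | S = go S s
    where
    go : ∀ {m} {F : Bool → Vec Bool m → Bool} → Stretch F → ∀ s → ∃ λ Γ → Ach (F s) Γ × # (F s) ^ suc (a + 4) ≤ℕ Γ * (2 ^ m) ^ (a + 4)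
    go {m} {F} (stretch t C e) s = Γ , achieved , ℕ.≤-trans (ℕ.≤-reflexive (ℕ.^-distribˡ-+-* (# (F s)) (suc a) 4))
        (ℕ.≤-trans (ℕ.*-monoʳ-≤ (# (F s) ^ suc a) (ℕ.^-monoˡ-≤ 4 below)) bound)
      where open Bounded (Crossing.crossing t C s {F s} (e s))

  -- Reduction from width 3 to two live states.

  continue : ∀ {r} → Vec Layer r → Maybe Bool → Vec Bool r → Bool
  continue L σ x = maybe′ (λ s → accepts L s x) false σ

  -- Names the two vertices other than the removed one by Booleans in increasing order; `vertex` is
  -- the inverse.
  label : Fin 3 → Fin 3 → Maybe Bool
  label zero             zero             = nothing
  label zero             (suc zero)       = just false
  label zero             (suc (suc zero)) = just true
  label (suc zero)       zero             = just false
  label (suc zero)       (suc zero)       = nothing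
  label (suc zero)       (suc (suc zero)) = just true
  label (suc (suc zero)) zero             = just false
  label (suc (suc zero)) (suc zero)       = just true
  label (suc (suc zero)) (suc (suc zero)) = nothing

  vertex : Fin 3 → Bool → Fin 3
  vertex zero             false = suc zero
  vertex zero             true  = suc (suc zero)
  vertex (suc zero)       false = zero
  vertex (suc zero)       true  = suc (suc zero)
  vertex (suc (suc zero)) false = zero
  vertex (suc (suc zero)) true  = suc zero

  data Labelled (u : Fin 3) : Fin 3 → Maybe Bool → Set where
    dead : Labelled u u nothing
    live : ∀ β → Labelled u (vertex u β) (just β)

  labelled : ∀ u v → Labelled u v (label u v)
  labelled zero             zero             = dead
  labelled zero             (suc zero)       = live false
  labelled zero             (suc (suc zero)) = live true
  labelled (suc zero)       zero             = live false
  labelled (suc zero)       (suc zero)       = dead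
  labelled (suc zero)       (suc (suc zero)) = live true
  labelled (suc (suc zero)) zero             = live false
  labelled (suc (suc zero)) (suc zero)       = live true
  labelled (suc (suc zero)) (suc (suc zero)) = dead

  argmin : ∀ (c : Fin 3 → ℕ) → ∃ λ u → ∀ v → c u ≤ℕ c v
  argmin c with ℕ.≤-total (c zero) (c (suc zero)) | ℕ.≤-total (c zero) (c (suc (suc zero))) | ℕ.≤-total (c (suc zero)) (c (suc (suc zero)))
  ... | inj₁ p | inj₁ q | _      = zero , λ { zero → ℕ.≤-refl ; (suc zero) → p ; (suc (suc zero)) → q }
  ... | inj₁ p | inj₂ q | _      = suc (suc zero) , λ { zero → q ; (suc zero) → ℕ.≤-trans q p ; (suc (suc zero)) → ℕ.≤-refl }
  ... | inj₂ p | _      | inj₁ q = suc zero , λ { zero → p ; (suc zero) → ℕ.≤-refl ; (suc (suc zero)) → q }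
  ... | inj₂ p | _      | inj₂ q = suc (suc zero) , λ { zero → ℕ.≤-trans q p ; (suc zero) → q ; (suc (suc zero)) → ℕ.≤-refl }

  -- The program below its first layer, with the least likely vertex of every later layer made rejecting.
  record Front {S r} (P : Prog 3 S (suc r)) : Set where
    field
      rest  : Vec Layer r
      first : S → Bool → Maybe Bool
      slack : ℕ
      least : ∀ s → slack ≤ℕ # (run P s)
      sound : ∀ s b x → continue rest (first s b) x ≡ true → run P s (b ∷ x) ≡ true
      close : ∀ s → # (run P s) ≤ℕ # (continue rest (first s false)) + # (continue rest (first s true)) + slack

  -- `slack` plays two roles: it bounds the loss of every vertex from above and the original count
  -- of every vertex from below.
  record Killed {r} (P : Prog 3 (Fin 3) r) : Set where
    field
      layers : Vec Layer r
      state  : Fin 3 → Maybe Bool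
      slack  : ℕ
      least  : ∀ v → slack ≤ℕ # (run P v)
      sound  : ∀ v x → continue layers (state v) x ≡ true → run P v x ≡ true
      close  : ∀ v → # (run P v) ≤ℕ # (continue layers (state v)) + slack

  -- Losses do not accumulate: a kept vertex loses at most the slack from below, and that is at most
  -- the count of the removed vertex itself.
  kill-bottom : ∀ {r} {P : Prog 3 (Fin 3) (suc r)} → Front P → Killed P
  kill-bottom {r} {P} Fr with argmin (λ v → # (run P v))
  ... | u , min = record
    { layers = L ; state = label u ; slack = # (run P u) ; least = min
    ; sound = sound′ ; close = close′ }
    where
    open Front Fr
    L : Vec Layer (suc r)
    L = (λ b β → first (vertex u β) b) ∷ rest
    sound′ : ∀ v x → continue L (label u v) x ≡ true → run P v x ≡ true
    sound′ v (b ∷ x) h with label u v | labelled u v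
    ... | _ | dead   = case h of λ ()
    ... | _ | live β = sound (vertex u β) b x h
    close′ : ∀ v → # (run P v) ≤ℕ # (continue L (label u v)) + # (run P u)
    close′ v with label u v | labelled u v
    ... | _ | dead   = ℕ.m≤n+m (# (run P u)) (# (continue L nothing))
    ... | _ | live β = ℕ.≤-trans (close (vertex u β))
      (ℕ.+-monoʳ-≤ (# (continue rest (first (vertex u β) false)) + # (continue rest (first (vertex u β) true))) (least u))

  front : ∀ {S r} (P : Prog 3 S (suc r)) → Front P
  kill  : ∀ {r} (P : Prog 3 (Fin 3) (suc r)) → Killed P

  front (last e) = record
    { rest  = []
    -- In the final layer the rejecting vertex is the removed one; it accepts nothing, so the slack
    -- is 0.
    ; first = λ s b → if e s b then just true else nothing
    ; slack = 0
    ; least = λ _ → z≤n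
    ; sound = λ s b → λ { [] h → trans (sym (accepted (e s b))) h }
    ; close = λ s → ℕ.≤-reflexive (trans (cong₂ (λ p q → bit p + bit q) (sym (accepted (e s false))) (sym (accepted (e s true)))) (sym (ℕ.+-identityʳ _)))
    }
    where
    accepted : ∀ c → continue [] (if c then just true else nothing) [] ≡ c
    accepted true  = refl
    accepted false = refl
  front (step e P) = record
    { rest  = layers
    ; first = λ s b → state (e s b)
    ; slack = slack + slack
    ; least = λ s → ℕ.+-mono-≤ (least (e s false)) (least (e s true))
    ; sound = λ s b x → sound (e s b) x
    ; close = λ s → ℕ.≤-trans (ℕ.+-mono-≤ (close (e s false)) (close (e s true)))
        (ℕ.≤-reflexive (interchange (# (continue layers (state (e s false)))) slack (# (continue layers (state (e s true))))))
    }
    where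
    open Killed (kill P)
    interchange : ∀ x k y → x + k + (y + k) ≡ x + y + (k + k)
    interchange = solve-∀

  kill P = kill-bottom (front P)

  -- Choice of the starting layer.

  -- slack only decreases along the layers, so one of the r layers drops it by at least B / r; start there.
  record Descent {r} (f : Vec Bool r → Bool) (B : ℕ) : Set where
    field
      {k m}  : ℕ
      length : k + m ≡ r
      layers : Vec Layer m
      start  : Bool
      sound  : ∀ y → accepts layers start y ≡ true → f (subst (Vec Bool) length (replicate k false ++ y)) ≡ true
      large  : B ≤ℕ r * (# (accepts layers start) * 2 ^ k)

  -- If stopping fails, this layer drops at most a share 1 / (R + 1) of `B`, so R / (R + 1) of it is
  -- left for the `R` remaining layers.
  pigeonhole : ∀ R {N B μ Q} .{{_ : NonZero R}} → suc R * N ≤ℕ B → B ≤ℕ N + (μ + μ) → μ ≤ℕ R * Q → B ≤ℕ suc R * (2 * Q)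
  pigeonhole R {N} {B} {μ} {Q} h k l = ℕ.*-cancelˡ-≤ R (≤-by (ℕ.+-mono-≤ h (ℕ.+-mono-≤ (ℕ.*-monoʳ-≤ (suc R) k) (ℕ.*-monoʳ-≤ (2 * suc R) l)))
    (identity R N B μ Q))
    where
    identity : ∀ R N B μ Q → R * B + (B + ((1 + R) * (N + (μ + μ)) + 2 * (1 + R) * (R * Q)))
      ≡ R * ((1 + R) * (2 * Q)) + ((1 + R) * N + ((1 + R) * B + 2 * (1 + R) * μ))
    identity = solve-∀

  -- Both states of the first layer imitate the start vertex.
  start-layers : ∀ {S r} (P : Prog 3 S (suc r)) → S → Vec Layer (suc r)
  start-layers P s = (λ b _ → Front.first (front P) s b) ∷ Front.rest (front P)

  stop : ∀ {S r} (P : Prog 3 S (suc r)) s {B} → B ≤ℕ suc r * (# (accepts (start-layers P s) true) * 1) → Descent (run P s) B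
  stop {r = r} P s h = record
    { k = 0 ; m = suc r ; length = refl ; layers = start-layers P s ; start = true
    ; sound = λ { (b ∷ x) → Front.sound (front P) s b x } ; large = h }

  descend : ∀ {S r} (P : Prog 3 S (suc r)) s B → (∀ s → B ≤ℕ # (run P s)) → Descent (run P s) B
  descend {S} {r} P s B h with ℕ.≤-total B (suc r * (# (accepts (start-layers P s) true) * 1))
  ... | inj₁ p = stop P s p
  -- With one layer left the slack is 0, so stopping succeeds.
  descend (last e) s B h | inj₂ p = stop (last e) s
    (ℕ.≤-trans (h s) (ℕ.≤-trans (Front.close (front (last e)) s) (ℕ.≤-reflexive (units (# (accepts (start-layers (last e) s) true))))))
    where
    units : ∀ n → n + 0 ≡ 1 * (n * 1)
    units = solve-∀
  descend {r = suc r} (step e P) s B h | inj₂ p = record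
    { k = suc k
    ; m = m
    ; length = cong suc length
    ; layers = layers
    ; start  = start
    ; sound  = λ y t → trans (cong (run (step e P) s) (subst-∷ length (replicate k false ++ y))) (sound y t)
    ; large  = ℕ.≤-trans (pigeonhole (suc r) {N} {B} {Killed.slack (kill P)} {# (accepts layers start) * 2 ^ k}
        (subst (λ z → suc (suc r) * z ≤ℕ B) (ℕ.*-identityʳ N) p)
        (ℕ.≤-trans (h s) (Front.close (front (step e P)) s)) large)
        (ℕ.≤-reflexive (regroup (suc (suc r)) (# (accepts layers start)) (2 ^ k)))
    }
    where
    -- Follow the edge 0; the least count in the layer reached is the new `B`.
    open Descent (descend P (e s false) (Killed.slack (kill P)) (Killed.least (kill P)))
    N = # (accepts (start-layers (step e P) s) true)
    subst-∷ : ∀ {i j b} (eq : i ≡ j) (v : Vec Bool i) → subst (Vec Bool) (cong suc eq) (b ∷ v) ≡ b ∷ subst (Vec Bool) eq v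
    subst-∷ refl v = refl
    regroup : ∀ r n k → r * (2 * (n * k)) ≡ r * (n * (2 * k))
    regroup = solve-∀

  -- From counts to rational expectations.

  -- Unnormalised rationals allow numerator and denominator to share factors.
  Frac : ℚ → ℕ → ℕ → Set
  Frac q x d = ∃ λ e → d ≡ suc e × toℚᵘ q ≃ᵘ mkℚᵘ (ℤ.+ x) e

  frac-/ : ∀ x d .{{_ : NonZero d}} → Frac ((ℤ.+ x) / d) x d
  frac-/ x (suc e) = e , refl , ℚ.toℚᵘ-fromℚᵘ (mkℚᵘ (ℤ.+ x) e)

  frac-* : ∀ {p q x y d d′} → Frac p x d → Frac q y d′ → Frac (p *ℚ q) (x * y) (d * d′)
  frac-* {p} {q} {x} {y} (e , refl , h) (e′ , refl , k) = e′ + e * suc e′ , refl ,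
    ℚᵘ.≃-trans (ℚ.toℚᵘ-homo-* p q) (ℚᵘ.≃-trans (ℚᵘ.*-cong h k) (ℚᵘ.≃-reflexive (cong (λ z → mkℚᵘ z (e′ + e * suc e′)) (sym (ℤ.pos-* x y)))))

  frac-^ : ∀ {q x d} n → Frac q x d → Frac (q ^ℚ n) (x ^ n) (d ^ n)
  frac-^ zero    h = 0 , refl , ℚᵘ.≃-refl
  frac-^ (suc n) h = frac-* h (frac-^ n h)

  frac-≤ : ∀ {p q x y d d′} → Frac p x d → Frac q y d′ → x * d′ ≤ℕ y * d → p ≤ℚ q
  frac-≤ {x = x} {y} (e , refl , h) (e′ , refl , k) l = ℚ.toℚᵘ-cancel-≤
    (ℚᵘ.≤-respˡ-≃ (ℚᵘ.≃-sym h) (ℚᵘ.≤-respʳ-≃ (ℚᵘ.≃-sym k)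
      (*≤* (subst₂ ℤ._≤_ (ℤ.pos-* x (suc e′)) (ℤ.pos-* y (suc e)) (ℤ.+≤+ l)))))

  -- Dividing out, E / (2^n n) ≤ N / 2^m, and the (a+1)-st power of the latter is at most Γ / 2^m.
  expectation-bound : ∀ {n k m E N Γ} a → k + m ≡ n → E ≤ℕ n * (N * 2 ^ k) → N ^ suc a ≤ℕ Γ * (2 ^ m) ^ a →
    (E * 1) ^ suc a * 2 ^ m ≤ℕ Γ * (2 ^ n * n) ^ suc a
  expectation-bound {n} {k} {m} {E} {N} {Γ} a refl h l = begin
    (E * 1) ^ suc a * 2 ^ m                                  ≡⟨ cong (λ z → z ^ suc a * 2 ^ m) (ℕ.*-identityʳ E) ⟩
    E ^ suc a * 2 ^ m                                         ≤⟨ ℕ.*-monoˡ-≤ (2 ^ m) (ℕ.^-monoˡ-≤ (suc a) h) ⟩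
    (n * (N * 2 ^ k)) ^ suc a * 2 ^ m                       ≡⟨ cong (_* 2 ^ m) (trans (cong (_^ suc a) (swap n N (2 ^ k))) (*-^ N (n * 2 ^ k) (suc a))) ⟩
    N ^ suc a * (n * 2 ^ k) ^ suc a * 2 ^ m                 ≤⟨ ℕ.*-monoˡ-≤ (2 ^ m) (ℕ.*-monoˡ-≤ ((n * 2 ^ k) ^ suc a) l) ⟩
    Γ * (2 ^ m) ^ a * (n * 2 ^ k) ^ suc a * 2 ^ m          ≡⟨ regroup Γ ((2 ^ m) ^ a) ((n * 2 ^ k) ^ suc a) (2 ^ m) ⟩
    Γ * ((n * 2 ^ k) ^ suc a * (2 ^ m) ^ suc a)             ≡⟨ cong (Γ *_) (*-^ (n * 2 ^ k) (2 ^ m) (suc a)) ⟨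
    Γ * (n * 2 ^ k * 2 ^ m) ^ suc a                         ≡⟨ cong (λ z → Γ * z ^ suc a) (trans (rotate n (2 ^ k) (2 ^ m)) (cong (_* n) (sym (ℕ.^-distribˡ-+-* 2 k m)))) ⟩
    Γ * (2 ^ n * n) ^ suc a                                  ∎
    where
    open ℕ.≤-Reasoning
    swap : ∀ n N k → n * (N * k) ≡ N * (n * k)
    swap = solve-∀
    regroup : ∀ g p q m → g * p * q * m ≡ g * (q * (m * p))
    regroup = solve-∀
    rotate : ∀ n k m → n * k * m ≡ k * m * n
    rotate = solve-∀

  conclude : ∀ {n} .{{_ : NonZero n}} {f : Vec Bool n → Bool} → Descent f (# f) →
    ∃ λ k → ∃ λ m → Σ (k + m ≡ n) λ eq → ∃ λ (g : CNF⊕ m) →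
      (∀ y → evalCNF⊕ g y ≡ true → f (subst (Vec Bool) eq (replicate k false ++ y)) ≡ true)
      × ((𝔼 f *ℚ (ℤ.+ 1 / n)) ^ℚ suc (a + 4) ≤ℚ 𝔼 (evalCNF⊕ g))
  conclude {n} {f} D with sudden-death (Descent.layers D) (Descent.start D)
  ... | Γ , ach φ φ-sound size , bound = k , m , length , φ , (λ y h → sound y (φ-sound y h)) ,
    frac-≤ (frac-^ (suc (a + 4)) (frac-* {p = 𝔼 f} (frac-/ (count f) (2 ^ n) {{ℕ.m^n≢0 2 n}}) (frac-/ 1 n)))
           (frac-/ (count (evalCNF⊕ φ)) (2 ^ m) {{ℕ.m^n≢0 2 m}})
           (expectation-bound {n} {k} {m} {count f} {# (accepts layers start)} {count (evalCNF⊕ φ)} (a + 4) length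
             (subst (_≤ℕ n * (# (accepts layers start) * 2 ^ k)) (sym (count≡# f)) large)
             (ℕ.≤-trans bound (ℕ.*-monoˡ-≤ ((2 ^ m) ^ (a + 4)) (subst (Γ ≤ℕ_) (sym (count≡# (evalCNF⊕ φ))) size))))
    where open Descent D

  along : ∀ {n} {f g : Vec Bool n → Bool} → (∀ x → f x ≡ g x) → Descent g (# g) → Descent f (# f)
  along f≗g D = record
    { k = k ; m = m ; length = length ; layers = layers ; start = start
    ; sound = λ y h → trans (f≗g _) (sound y h)
    ; large = subst (_≤ℕ _) (sym (#-cong f≗g)) large }
    where open Descent D

open Reduction
open import Data.Integer using (+_)
open import Data.Rational using (_≤_; _*_)

theorem6p2 : ∃ λ (C : ℕ) →
    ∀ (n : ℕ) .{{_ : NonZero n}} (f : Vec Bool n → Bool) →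
    (∃ λ (P : ROBP 3 n) → ∀ x → f x ≡ evalROBP P x) →
    ∃ λ (k : ℕ) → ∃ λ (m : ℕ) → Σ (k + m ≡ n) λ eq → ∃ λ (g : CNF⊕ m) →
    (∀ (y : Vec Bool m) → evalCNF⊕ g y ≡ true →
    f (subst (Vec Bool) eq (replicate k false ++ y)) ≡ true)
    × ((𝔼 f * ((+ 1) / n)) ^ℚ C ≤ 𝔼 (evalCNF⊕ g))
-- The exponent is 34 + 4 = 38. As the first layer is a single vertex, its own count is the least
-- one there.
theorem6p2 = suc (a + 4) , λ { (suc r) f (P , f≗P) → conclude (along f≗P (descend P tt (# (run P tt)) (λ _ → ℕ.≤-refl))) }
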